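{- For integers $c\geq 1$ and $n\geq 0$, let $a_c(n)$ be defined by $\sum_{n\geq 0} a_c(n)q^n=\prod_{j\geq 1}\frac{1}{(1-q^j)(1-q^{2j})^{c-1}}$. Then for all $n\geq 0$, $$a_3(7n+4)\equiv 0\pmod{7}\quad\text{and}\quad a_5(11n+10)\equiv 0\pmod{11}.$$
   Context: Combinatorially, $a_c(n)$ is the number of partitions of $n$ in which each even part may appear in $c$ different colors, with $a_c(0)=1$. -}

module Defs where

open import Data.Nat using (ℕ; zero; suc; _+_; _*_; _∸_; _%_)
open import Data.List using (map; upTo)
open import Data.Nat.ListAction using (sum)

Series : Set
Series = ℕ → ℕ

one : Series
one zero    = 1
one (suc _) = 0

_·_ : Series → Series → Series
(f · g) n = sum (map (λ i → f i * g (n ∸ i)) (upTo (suc n)))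

infixl 7 _·_

_^ˢ_ : Series → ℕ → Series
f ^ˢ zero  = one
f ^ˢ suc k = f · (f ^ˢ k)

-- geom k = 1/(1 - q^k) = Σ_{m ≥ 0} q^{k m}, for k ≥ 1 (k = suc i)
-- coefficient of q^m is 1 if k ∣ m and 0 otherwise.
geom : (i : ℕ) → Series
geom i m with m % suc i
... | zero  = 1
... | suc _ = 0

partialProd : (c N : ℕ) → Series
partialProd c zero    = one
partialProd c (suc N) =
  partialProd c N · (geom N · (geom (N + suc N) ^ˢ (c ∸ 1)))
  -- j = suc N;  geom N = 1/(1-q^{N+1}),  geom (N + suc N) = 1/(1-q^{2(N+1)})

-- a_c(n): the coefficient of q^n in Π_{j≥1} 1/((1-q^j)(1-q^{2j})^{c-1}).
-- Factors with j > n contribute 1 + O(q^{n+1}), so the coefficient of q^n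
-- is that of the partial product up to j = n.
a : (c n : ℕ) → ℕ
a c n = partialProd c n n

module Submission where

-- Write P = ∏ (1 - qʲ), Q = ∏ (1 - q²ʲ) and F = ∑ (6k + 1) q^(k(3k+1)/2) over k ∈ ℤ.  The key
-- identity is F Q² = P⁵.  It follows from three specialisations of Jacobi's triple product,
--   ∑ (-1)ᵏ q^(k(3k+1)/2) = P,   ∑ (4s + 1) q^(s(2s+1)) = P³,   P ∑ q^(s(2s+1)) = Q²,
-- because P · P³ = F · ∑ q^(s(2s+1)): the difference of the two double series is a sum over a
-- lattice on which an involution preserves the exponent and negates the coefficient.
--
-- The generating functions are 1/(P Q²) and 1/(P Q⁴), and Pᵖ ≡ ∏ (1 - qᵖʲ) (mod p).  Hence, up to
-- factors that are series in q⁷ and q¹¹, they are P F modulo 7 and F² modulo 11.  The coefficients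
-- of these at qⁱ are sums over x² + y² = 24i + 2 with x ≡ y ≡ 1 (mod 6), weighted by multiples of y.
-- For i ≡ 4 (mod 7) and i ≡ 10 (mod 11) the prime divides x² + y², and since it is 3 modulo 4 it
-- divides y.
--
-- Infinite products and sums are replaced by finite ones by working modulo a power of q, so that
-- q is a nilpotent element of a commutative ring.

-- The two primes fit because `7 = 1 + 1 + 5` and `11 = 1 + 5 + 5`: P⁷ / (P Q²) = P · (P⁵ / Q²) = P
-- F, and P¹¹ / (P Q⁴) = (P⁵ / Q²)² = F². Two of the three specialisations are degenerate. With
-- `v = 1` every triangular number occurs twice, and the resulting factor 2 has to be cancelled;
-- hence coefficients are taken modulo an odd prime, where ½ exists. For P³ both sides of the triple
-- product vanish at `v = -1` and a derivative is required; it is the coefficient of `x` over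
-- R[x]/(x²). This is why the triple product is proved over an arbitrary commutative ring with
-- nilpotent `q`: it is applied with bases `q` and `q³`, and again over dual numbers. The involution
-- and the substitutions before it shift indices, and a finite range of summation is not stable
-- under shifts. The windows are therefore chosen so wide that every term which a shift moves in or
-- out is zero.

open import Algebra.Bundles using (CommutativeRing)
open import Data.Integer.Base as ℤ using (ℤ; +_; -[1+_]; ∣_∣)
import Data.Integer.Divisibility.Signed as ℤ
import Data.Integer.Properties as ℤ
open import Data.Nat.Base as ℕ using (ℕ; NonZero; zero; suc; z≤n; s≤s)
import Data.Nat.Properties as ℕ
open import Relation.Nullary.Decidable.Core using (yes; no)
import Relation.Binary.PropositionalEquality as ≡
open ≡ using (_≡_; _≢_)

-- Integer multiples of one, and polynomial identities with integer coefficients in any commutative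
-- ring.

module IntegerMultiples {c ℓ} (R : CommutativeRing c ℓ) where

  open import Algebra.Solver.Ring.AlmostCommutativeRing
    using (fromCommutativeRing; _-Raw-AlmostCommutative⟶_)
  open import Data.Integer.Base using (_⊖_)
  open import Data.Maybe.Base using (Maybe; just; nothing)

  open CommutativeRing R hiding (zero)
  open import Algebra.Properties.Ring ring
  open import Algebra.Properties.AbelianGroup +-abelianGroup using (⁻¹-∙-comm)
  open import Algebra.Properties.Group +-group using (⁻¹-involutive; ε⁻¹≈ε)
  open import Algebra.Properties.Semiring.Mult.TCOptimised semiring
  open import Relation.Binary.Reasoning.Setoid setoid

  ⟦_⟧ : ℤ → Carrier
  ⟦ + n ⟧      = n × 1#
  ⟦ -[1+ n ] ⟧ = - (suc n × 1#)

  ⟦suc⟧ : ∀ n → ⟦ + suc n ⟧ ≈ 1# + ⟦ + n ⟧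
  ⟦suc⟧ n = ×-homo-+ 1# 1 n

  ⟦⊖⟧ : ∀ m n → ⟦ m ⊖ n ⟧ ≈ ⟦ + m ⟧ - ⟦ + n ⟧
  ⟦⊖⟧ m zero = begin
    ⟦ + m ⟧      ≈⟨ +-identityʳ _ ⟨
    ⟦ + m ⟧ + 0# ≈⟨ +-congˡ ε⁻¹≈ε ⟨
    ⟦ + m ⟧ - 0# ∎
  ⟦⊖⟧ zero (suc n) = sym (+-identityˡ _)
  ⟦⊖⟧ (suc m) (suc n) = begin
    ⟦ suc m ⊖ suc n ⟧                   ≡⟨ ≡.cong ⟦_⟧ (ℤ.[1+m]⊖[1+n]≡m⊖n m n) ⟩
    ⟦ m ⊖ n ⟧                           ≈⟨ ⟦⊖⟧ m n ⟩
    ⟦ + m ⟧ - ⟦ + n ⟧                   ≈⟨ +-congʳ (+-identityˡ _) ⟨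
    0# + ⟦ + m ⟧ - ⟦ + n ⟧              ≈⟨ +-congʳ (+-congʳ (-‿inverseʳ 1#)) ⟨
    1# - 1# + ⟦ + m ⟧ - ⟦ + n ⟧         ≈⟨ +-congʳ (+-assoc _ _ _) ⟩
    1# + (- 1# + ⟦ + m ⟧) - ⟦ + n ⟧     ≈⟨ +-congʳ (+-congˡ (+-comm _ _)) ⟩
    1# + (⟦ + m ⟧ - 1#) - ⟦ + n ⟧       ≈⟨ +-congʳ (+-assoc _ _ _) ⟨
    1# + ⟦ + m ⟧ - 1# - ⟦ + n ⟧         ≈⟨ +-assoc _ _ _ ⟩
    1# + ⟦ + m ⟧ + (- 1# - ⟦ + n ⟧)     ≈⟨ +-congˡ (⁻¹-∙-comm 1# _) ⟩
    1# + ⟦ + m ⟧ - (1# + ⟦ + n ⟧)       ≈⟨ +-cong (⟦suc⟧ m) (-‿cong (⟦suc⟧ n)) ⟨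
    ⟦ + suc m ⟧ - ⟦ + suc n ⟧           ∎

  ⟦+⟧ : ∀ i j → ⟦ i ℤ.+ j ⟧ ≈ ⟦ i ⟧ + ⟦ j ⟧
  ⟦+⟧ (+ m)    (+ n)    = ×-homo-+ 1# m n
  ⟦+⟧ (+ m)    -[1+ n ] = ⟦⊖⟧ m (suc n)
  ⟦+⟧ -[1+ m ] (+ n)    = trans (⟦⊖⟧ n (suc m)) (+-comm _ _)
  ⟦+⟧ -[1+ m ] -[1+ n ] = begin
    ⟦ -[1+ suc (m ℕ.+ n) ] ⟧               ≡⟨ ≡.cong ⟦_⟧ (ℤ.neg-distrib-+ (+ suc m) (+ suc n)) ⟨
    - ((suc m ℕ.+ suc n) × 1#)             ≈⟨ -‿cong (×-homo-+ 1# (suc m) (suc n)) ⟩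
    - (suc m × 1# + suc n × 1#)            ≈⟨ ⁻¹-∙-comm _ _ ⟨
    ⟦ -[1+ m ] ⟧ + ⟦ -[1+ n ] ⟧            ∎

  ⟦-⟧ : ∀ i → ⟦ ℤ.- i ⟧ ≈ - ⟦ i ⟧
  ⟦-⟧ (+ zero)  = sym ε⁻¹≈ε
  ⟦-⟧ (+ suc n) = refl
  ⟦-⟧ -[1+ n ]  = sym (⁻¹-involutive _)

  ⟦+*⟧ : ∀ m j → ⟦ + m ℤ.* j ⟧ ≈ ⟦ + m ⟧ * ⟦ j ⟧
  ⟦+*⟧ m (+ n) = begin
    ⟦ + m ℤ.* + n ⟧       ≡⟨ ≡.cong ⟦_⟧ (ℤ.pos-* m n) ⟨
    ⟦ + (m ℕ.* n) ⟧       ≈⟨ ×1-homo-* m n ⟩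
    ⟦ + m ⟧ * ⟦ + n ⟧     ∎
  ⟦+*⟧ m -[1+ n ] = begin
    ⟦ + m ℤ.* -[1+ n ] ⟧        ≡⟨ ≡.cong ⟦_⟧ (ℤ.neg-distribʳ-* (+ m) (+ suc n)) ⟨
    ⟦ ℤ.- (+ m ℤ.* + suc n) ⟧   ≈⟨ ⟦-⟧ (+ m ℤ.* + suc n) ⟩
    - ⟦ + m ℤ.* + suc n ⟧       ≈⟨ -‿cong (⟦+*⟧ m (+ suc n)) ⟩
    - (⟦ + m ⟧ * ⟦ + suc n ⟧)   ≈⟨ -‿distribʳ-* _ _ ⟩
    ⟦ + m ⟧ * ⟦ -[1+ n ] ⟧      ∎

  ⟦*⟧ : ∀ i j → ⟦ i ℤ.* j ⟧ ≈ ⟦ i ⟧ * ⟦ j ⟧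
  ⟦*⟧ (+ m)    j = ⟦+*⟧ m j
  ⟦*⟧ -[1+ m ] j = begin
    ⟦ -[1+ m ] ℤ.* j ⟧          ≡⟨ ≡.cong ⟦_⟧ (ℤ.neg-distribˡ-* (+ suc m) j) ⟨
    ⟦ ℤ.- (+ suc m ℤ.* j) ⟧     ≈⟨ ⟦-⟧ (+ suc m ℤ.* j) ⟩
    - ⟦ + suc m ℤ.* j ⟧         ≈⟨ -‿cong (⟦+*⟧ (suc m) j) ⟩
    - (⟦ + suc m ⟧ * ⟦ j ⟧)     ≈⟨ -‿distribˡ-* _ _ ⟩
    ⟦ -[1+ m ] ⟧ * ⟦ j ⟧        ∎

  ⟦⟧-homomorphism : CommutativeRing.rawRing ℤ.+-*-commutativeRing
                    -Raw-AlmostCommutative⟶ fromCommutativeRing R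
  ⟦⟧-homomorphism = record
    { ⟦_⟧    = ⟦_⟧
    ; +-homo = ⟦+⟧
    ; *-homo = ⟦*⟧
    ; -‿homo = ⟦-⟧
    ; 0-homo = refl
    ; 1-homo = refl
    }

  ⟦⟧-≟ : ∀ i j → Maybe (⟦ i ⟧ ≈ ⟦ j ⟧)
  ⟦⟧-≟ i j with i ℤ.≟ j
  ... | yes i≡j = just (reflexive (≡.cong ⟦_⟧ i≡j))
  ... | no  _   = nothing

  open import Algebra.Solver.Ring _ _ ⟦⟧-homomorphism ⟦⟧-≟ public
    using (solve; _:+_; _:*_; _:-_; :-_; _:^_; con; _:=_)

-- Sums over the pairs of naturals with a given total.

module AntidiagonalSums {c ℓ} (R : CommutativeRing c ℓ) where

  open CommutativeRing R hiding (zero)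
  open import Algebra.Properties.CommutativeSemigroup +-commutativeSemigroup
    using (interchange; x∙yz≈y∙xz)
  open import Relation.Binary.Reasoning.Setoid setoid

  ∑ : ℕ → (ℕ → ℕ → Carrier) → Carrier
  ∑ zero    g = g 0 0
  ∑ (suc n) g = g 0 (suc n) + ∑ n (λ i j → g (suc i) j)

  ∑-cong′ : ∀ n {g h} → (∀ i j → i ℕ.+ j ≡ n → g i j ≈ h i j) → ∑ n g ≈ ∑ n h
  ∑-cong′ zero    g≈h = g≈h 0 0 ≡.refl
  ∑-cong′ (suc n) g≈h = +-cong (g≈h 0 (suc n) ≡.refl)
    (∑-cong′ n (λ i j i+j≡n → g≈h (suc i) j (≡.cong suc i+j≡n)))

  ∑-cong : ∀ n {g h} → (∀ i j → g i j ≈ h i j) → ∑ n g ≈ ∑ n h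
  ∑-cong n g≈h = ∑-cong′ n (λ i j _ → g≈h i j)

  ∑-zero : ∀ n {g} → (∀ i j → i ℕ.+ j ≡ n → g i j ≈ 0#) → ∑ n g ≈ 0#
  ∑-zero zero    g≈0 = g≈0 0 0 ≡.refl
  ∑-zero (suc n) g≈0 = trans (+-cong (g≈0 0 (suc n) ≡.refl)
    (∑-zero n (λ i j i+j≡n → g≈0 (suc i) j (≡.cong suc i+j≡n)))) (+-identityˡ 0#)

  ∑-+ : ∀ n g h → ∑ n (λ i j → g i j + h i j) ≈ ∑ n g + ∑ n h
  ∑-+ zero    g h = refl
  ∑-+ (suc n) g h = trans (+-congˡ (∑-+ n _ _)) (interchange _ _ _ _)

  *-∑ : ∀ n x g → x * ∑ n g ≈ ∑ n (λ i j → x * g i j)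
  *-∑ zero    x g = refl
  *-∑ (suc n) x g = trans (distribˡ _ _ _) (+-congˡ (*-∑ n x _))

  ∑-* : ∀ n x g → ∑ n g * x ≈ ∑ n (λ i j → g i j * x)
  ∑-* n x g = trans (*-comm _ x) (trans (*-∑ n x g) (∑-cong n (λ i j → *-comm x _)))

  ∑-last : ∀ n g → ∑ (suc n) g ≈ g (suc n) 0 + ∑ n (λ i j → g i (suc j))
  ∑-last zero    g = +-comm _ _
  ∑-last (suc n) g = begin
    g 0 (suc (suc n)) + ∑ (suc n) (λ i j → g (suc i) j)
      ≈⟨ +-congˡ (∑-last n (λ i j → g (suc i) j)) ⟩
    g 0 (suc (suc n)) + (g (suc (suc n)) 0 + ∑ n (λ i j → g (suc i) (suc j)))
      ≈⟨ x∙yz≈y∙xz _ _ _ ⟩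
    g (suc (suc n)) 0 + (g 0 (suc (suc n)) + ∑ n (λ i j → g (suc i) (suc j))) ∎

  ∑-flip : ∀ n g → ∑ n g ≈ ∑ n (λ i j → g j i)
  ∑-flip zero    g = refl
  ∑-flip (suc n) g = trans (+-congˡ (∑-flip n _)) (sym (∑-last n (λ i j → g j i)))

  -- Both sides range over the triples `j + k + l = n`, grouped as `(j + k) + l` and as
  -- `j + (k + l)`. This is what makes convolution associative.
  ∑-assoc : ∀ n (g : ℕ → ℕ → ℕ → Carrier) →
            ∑ n (λ i l → ∑ i (λ j k → g j k l)) ≈ ∑ n (λ j i → ∑ i (λ k l → g j k l))
  ∑-assoc zero    g = refl
  ∑-assoc (suc n) g = begin
    g 0 0 (suc n) + ∑ n (λ i l → g 0 (suc i) l + ∑ i (λ j k → g (suc j) k l))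
      ≈⟨ +-congˡ (∑-+ n _ _) ⟩
    g 0 0 (suc n) + (∑ n (λ i l → g 0 (suc i) l) + ∑ n (λ i l → ∑ i (λ j k → g (suc j) k l)))
      ≈⟨ +-assoc _ _ _ ⟨
    ∑ (suc n) (g 0) + ∑ n (λ i l → ∑ i (λ j k → g (suc j) k l))
      ≈⟨ +-congˡ (∑-assoc n (λ j → g (suc j))) ⟩
    ∑ (suc n) (g 0) + ∑ n (λ j i → ∑ i (λ k l → g (suc j) k l)) ∎

-- Power series modulo a power of the variable.

module TruncatedSeries {c ℓ} (R : CommutativeRing c ℓ) (N : ℕ) where

  open import Data.Product.Base using (_,_)
  open import Relation.Nullary.Negation.Core using (contradiction)

  open CommutativeRing R hiding (zero)
  open AntidiagonalSums R

  Series : Set c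
  Series = ℕ → Carrier

  -- Equality in R⟦x⟧ / (xᴺ⁺¹).
  infix 4 _≋_
  _≋_ : Series → Series → Set ℓ
  f ≋ g = ∀ n → n ℕ.≤ N → f n ≈ g n

  infixl 6 _⊕_
  infixl 7 _⊛_

  _⊕_ _⊛_ : Series → Series → Series
  (f ⊕ g) n = f n + g n
  (f ⊛ g) n = ∑ n (λ i j → f i * g j)

  const : Carrier → Series
  const a zero    = a
  const a (suc n) = 0#

  shift : Series → Series
  shift f zero    = 0#
  shift f (suc n) = f n

  ⊛-cong : ∀ {f f′ g g′} → f ≋ f′ → g ≋ g′ → f ⊛ g ≋ f′ ⊛ g′
  ⊛-cong f≋f′ g≋g′ n n≤N = ∑-cong′ n λ i j i+j≡n → *-cong
    (f≋f′ i (ℕ.≤-trans (ℕ.≤-trans (ℕ.m≤m+n i j) (ℕ.≤-reflexive i+j≡n)) n≤N))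
    (g≋g′ j (ℕ.≤-trans (ℕ.≤-trans (ℕ.m≤n+m j i) (ℕ.≤-reflexive i+j≡n)) n≤N))

  ⊛-assoc : ∀ f g h n → ((f ⊛ g) ⊛ h) n ≈ (f ⊛ (g ⊛ h)) n
  ⊛-assoc f g h n =
    trans (∑-cong n (λ i l → ∑-* i (h l) (λ j k → f j * g k)))
    (trans (∑-assoc n (λ j k l → f j * g k * h l))
    (∑-cong n (λ j i → trans (∑-cong i (λ k l → *-assoc (f j) (g k) (h l)))
                             (sym (*-∑ i (f j) (λ k l → g k * h l))))))

  ⊛-comm : ∀ f g n → (f ⊛ g) n ≈ (g ⊛ f) n
  ⊛-comm f g n = trans (∑-flip n _) (∑-cong n (λ i j → *-comm _ _))

  const-⊛ : ∀ a f n → (const a ⊛ f) n ≈ a * f n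
  const-⊛ a f zero    = refl
  const-⊛ a f (suc n) =
    trans (+-congˡ (∑-zero n (λ i j _ → zeroˡ (f j)))) (+-identityʳ _)

  ⊛-identityˡ : ∀ f n → (const 1# ⊛ f) n ≈ f n
  ⊛-identityˡ f n = trans (const-⊛ 1# f n) (*-identityˡ (f n))

  ⊛-distribˡ : ∀ f g h n → (f ⊛ (g ⊕ h)) n ≈ ((f ⊛ g) ⊕ (f ⊛ h)) n
  ⊛-distribˡ f g h n = trans (∑-cong n (λ i j → distribˡ (f i) (g j) (h j))) (∑-+ n _ _)

  ⊛-distribʳ : ∀ f g h n → ((g ⊕ h) ⊛ f) n ≈ ((g ⊛ f) ⊕ (h ⊛ f)) n
  ⊛-distribʳ f g h n = trans (∑-cong n (λ i j → distribʳ (f j) (g i) (h i))) (∑-+ n _ _)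

  truncatedSeries : CommutativeRing c ℓ
  truncatedSeries = record
    { Carrier = Series
    ; _≈_     = _≋_
    ; _+_     = _⊕_
    ; _*_     = _⊛_
    ; -_      = λ f n → - f n
    ; 0#      = λ _ → 0#
    ; 1#      = const 1#
    ; isCommutativeRing = record
      { isRing = record
        { +-isAbelianGroup = record
          { isGroup = record
            { isMonoid = record
              { isSemigroup = record
                { isMagma = record
                  { isEquivalence = record
                    { refl  = λ _ _ → refl
                    ; sym   = λ f≋g n n≤N → sym (f≋g n n≤N)
                    ; trans = λ f≋g g≋h n n≤N → trans (f≋g n n≤N) (g≋h n n≤N)
                    }
                  ; ∙-cong = λ f≋f′ g≋g′ n n≤N → +-cong (f≋f′ n n≤N) (g≋g′ n n≤N)
                  }
                ; assoc = λ f g h n _ → +-assoc (f n) (g n) (h n)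
                }
              ; identity = (λ f n _ → +-identityˡ (f n)) , (λ f n _ → +-identityʳ (f n))
              }
            ; inverse = (λ f n _ → -‿inverseˡ (f n)) , (λ f n _ → -‿inverseʳ (f n))
            ; ⁻¹-cong = λ f≋g n n≤N → -‿cong (f≋g n n≤N)
            }
          ; comm = λ f g n _ → +-comm (f n) (g n)
          }
        ; *-cong     = ⊛-cong
        ; *-assoc    = λ f g h n _ → ⊛-assoc f g h n
        ; *-identity = (λ f n _ → ⊛-identityˡ f n)
                     , (λ f n _ → trans (⊛-comm f _ n) (⊛-identityˡ f n))
        ; distrib    = (λ f g h n _ → ⊛-distribˡ f g h n) , (λ f g h n _ → ⊛-distribʳ f g h n)
        }
      ; *-comm = λ f g n _ → ⊛-comm f g n
      }
    }

  x : Series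
  x = shift (const 1#)

  x-⊛ : ∀ f n → (x ⊛ f) n ≈ shift f n
  x-⊛ f zero    = zeroˡ (f 0)
  x-⊛ f (suc n) = trans (+-congʳ (zeroˡ (f (suc n)))) (trans (+-identityˡ _) (⊛-identityˡ f n))

  open import Algebra.Properties.Semiring.Exp
    (CommutativeRing.semiring truncatedSeries) using () renaming (_^_ to _↑_)

  x↑-⊛-∸ : ∀ k f n → k ℕ.≤ n → ((x ↑ k) ⊛ f) n ≈ f (n ℕ.∸ k)
  x↑-⊛-∸ zero    f n       _         = ⊛-identityˡ f n
  x↑-⊛-∸ (suc k) f (suc n) (s≤s k≤n) = trans (⊛-assoc x (x ↑ k) f (suc n))
    (trans (x-⊛ ((x ↑ k) ⊛ f) (suc n)) (x↑-⊛-∸ k f n k≤n))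

  x↑-⊛-< : ∀ k f n → n ℕ.< k → ((x ↑ k) ⊛ f) n ≈ 0#
  x↑-⊛-< (suc k) f zero    _         = trans (⊛-assoc x (x ↑ k) f 0) (x-⊛ ((x ↑ k) ⊛ f) 0)
  x↑-⊛-< (suc k) f (suc n) (s≤s n<k) = trans (⊛-assoc x (x ↑ k) f (suc n))
    (trans (x-⊛ ((x ↑ k) ⊛ f) (suc n)) (x↑-⊛-< k f n n<k))

  x↑-coefficient : ∀ k n → n ≢ k → (x ↑ k) n ≈ 0#
  x↑-coefficient zero    zero    n≢k = contradiction ≡.refl n≢k
  x↑-coefficient zero    (suc n) _   = refl
  x↑-coefficient (suc k) zero    _   = x-⊛ (x ↑ k) 0
  x↑-coefficient (suc k) (suc n) n≢k =
    trans (x-⊛ (x ↑ k) (suc n)) (x↑-coefficient k n (λ n≡k → n≢k (≡.cong suc n≡k)))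

-- Sums over symmetric windows of integers, and their invariance under shifts.

module IntervalSums {c ℓ} (R : CommutativeRing c ℓ) where

  open CommutativeRing R hiding (zero)
  open import Algebra.Properties.CommutativeSemigroup +-commutativeSemigroup using (interchange)
  open import Relation.Binary.Reasoning.Setoid setoid
  open IntegerMultiples R using (solve; _:+_; _:=_)
  open AntidiagonalSums R

  ∑< : ℕ → (ℕ → Carrier) → Carrier
  ∑< zero    f = 0#
  ∑< (suc n) f = ∑< n f + f n

  ∑<-cong : ∀ n {f g} → (∀ i → f i ≈ g i) → ∑< n f ≈ ∑< n g
  ∑<-cong zero    f≈g = refl
  ∑<-cong (suc n) f≈g = +-cong (∑<-cong n f≈g) (f≈g n)

  ∑<-zero : ∀ n {f} → (∀ i → i ℕ.< n → f i ≈ 0#) → ∑< n f ≈ 0#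
  ∑<-zero zero    f≈0 = refl
  ∑<-zero (suc n) f≈0 = trans
    (+-cong (∑<-zero n (λ i i<n → f≈0 i (ℕ.m<n⇒m<1+n i<n))) (f≈0 n ℕ.≤-refl)) (+-identityˡ 0#)

  ∑<-+ : ∀ n f g → ∑< n (λ i → f i + g i) ≈ ∑< n f + ∑< n g
  ∑<-+ zero    f g = sym (+-identityˡ 0#)
  ∑<-+ (suc n) f g = trans (+-congʳ (∑<-+ n f g)) (interchange _ _ _ _)

  *-∑< : ∀ n x f → x * ∑< n f ≈ ∑< n (λ i → x * f i)
  *-∑< zero    x f = zeroʳ x
  *-∑< (suc n) x f = trans (distribˡ _ _ _) (+-congʳ (*-∑< n x f))

  ∑<-swap : ∀ m n (f : ℕ → ℕ → Carrier) →
            ∑< m (λ i → ∑< n (f i)) ≈ ∑< n (λ j → ∑< m (λ i → f i j))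
  ∑<-swap zero    n f = sym (∑<-zero n (λ _ _ → refl))
  ∑<-swap (suc m) n f = trans (+-congʳ (∑<-swap m n f)) (sym (∑<-+ n _ _))

  ∑<-suc : ∀ n f → ∑< (suc n) f ≈ f 0 + ∑< n (λ i → f (suc i))
  ∑<-suc zero    f = +-comm _ _
  ∑<-suc (suc n) f = trans (+-congʳ (∑<-suc n f)) (+-assoc _ _ _)

  ∑<-pairs : ∀ n f → ∑< (n ℕ.+ n) f ≈ ∑< n (λ i → f (i ℕ.+ i) + f (suc (i ℕ.+ i)))
  ∑<-pairs zero    f = refl
  ∑<-pairs (suc n) f rewrite ℕ.+-suc n n =
    trans (+-assoc _ _ _) (+-congʳ (∑<-pairs n f))

  ∑-snd : ∀ n f → ∑ n (λ i j → f j) ≈ ∑< (suc n) f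
  ∑-snd zero    f = sym (+-identityˡ _)
  ∑-snd (suc n) f = trans (+-comm _ _) (+-congʳ (∑-snd n f))

  -- The sum of g k over - n ≤ k ≤ n.
  ∑ℤ : ℕ → (ℤ → Carrier) → Carrier
  ∑ℤ n g = ∑< (suc n) (λ k → g (+ k)) + ∑< n (λ k → g -[1+ k ])

  -- Even indices enumerate `0 ≤ k < n` and odd ones `-n ≤ k < 0`. The window also contains `k = n`,
  -- hence the last hypothesis.
  ∑<-∑ℤ : ∀ n f g → (∀ i → f (i ℕ.+ i) ≈ g (+ i)) → (∀ i → f (suc (i ℕ.+ i)) ≈ g -[1+ i ]) →
          g (+ n) ≈ 0# → ∑< (n ℕ.+ n) f ≈ ∑ℤ n g
  ∑<-∑ℤ n f g even odd g≈0 = begin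
    ∑< (n ℕ.+ n) f
      ≈⟨ ∑<-pairs n f ⟩
    ∑< n (λ i → f (i ℕ.+ i) + f (suc (i ℕ.+ i)))
      ≈⟨ ∑<-cong n (λ i → +-cong (even i) (odd i)) ⟩
    ∑< n (λ i → g (+ i) + g -[1+ i ])
      ≈⟨ ∑<-+ n _ _ ⟩
    ∑< n (λ i → g (+ i)) + ∑< n (λ i → g -[1+ i ])
      ≈⟨ +-congʳ (trans (+-congˡ g≈0) (+-identityʳ _)) ⟨
    ∑ℤ n g ∎

  ∑ℤ-cong : ∀ n {f g} → (∀ k → f k ≈ g k) → ∑ℤ n f ≈ ∑ℤ n g
  ∑ℤ-cong n f≈g =
    +-cong (∑<-cong (suc n) (λ k → f≈g (+ k))) (∑<-cong n (λ k → f≈g -[1+ k ]))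

  ∑ℤ-zero : ∀ n {f} → (∀ k → f k ≈ 0#) → ∑ℤ n f ≈ 0#
  ∑ℤ-zero n f≈0 = trans (+-cong (∑<-zero (suc n) (λ k _ → f≈0 (+ k)))
    (∑<-zero n (λ k _ → f≈0 -[1+ k ]))) (+-identityˡ 0#)

  ∑ℤ-+ : ∀ n f g → ∑ℤ n (λ k → f k + g k) ≈ ∑ℤ n f + ∑ℤ n g
  ∑ℤ-+ n f g = trans (+-cong (∑<-+ (suc n) _ _) (∑<-+ n _ _)) (interchange _ _ _ _)

  *-∑ℤ : ∀ n x f → x * ∑ℤ n f ≈ ∑ℤ n (λ k → x * f k)
  *-∑ℤ n x f = trans (distribˡ _ _ _) (+-cong (*-∑< (suc n) x _) (*-∑< n x _))

  ∑ℤ-swap : ∀ m n (f : ℤ → ℤ → Carrier) →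
            ∑ℤ m (λ i → ∑ℤ n (f i)) ≈ ∑ℤ n (λ j → ∑ℤ m (λ i → f i j))
  ∑ℤ-swap m n f = begin
    ∑< (suc m) (λ i → ∑ℤ n (f (+ i))) + ∑< m (λ i → ∑ℤ n (f -[1+ i ]))
      ≈⟨ +-cong (lemma (suc m) (λ k → + k)) (lemma m -[1+_]) ⟩
    ∑ℤ n (λ j → ∑< (suc m) (λ i → f (+ i) j)) + ∑ℤ n (λ j → ∑< m (λ i → f -[1+ i ] j))
      ≈⟨ ∑ℤ-+ n (λ j → ∑< (suc m) (λ i → f (+ i) j)) (λ j → ∑< m (λ i → f -[1+ i ] j)) ⟨
    ∑ℤ n (λ j → ∑ℤ m (λ i → f i j)) ∎
    where
    lemma : ∀ m (h : ℕ → ℤ) →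
            ∑< m (λ i → ∑ℤ n (f (h i))) ≈ ∑ℤ n (λ j → ∑< m (λ i → f (h i) j))
    lemma m h = trans (∑<-+ m _ _) (+-cong (∑<-swap m (suc n) _) (∑<-swap m n _))

  ∑ℤ-*-∑ℤ : ∀ m n f g → ∑ℤ m f * ∑ℤ n g ≈ ∑ℤ m (λ i → ∑ℤ n (λ j → f i * g j))
  ∑ℤ-*-∑ℤ m n f g = begin
    ∑ℤ m f * ∑ℤ n g                       ≈⟨ *-comm _ _ ⟩
    ∑ℤ n g * ∑ℤ m f                       ≈⟨ *-∑ℤ m _ f ⟩
    ∑ℤ m (λ i → ∑ℤ n g * f i)             ≈⟨ ∑ℤ-cong m (λ i → trans (*-comm _ _) (*-∑ℤ n (f i) g)) ⟩
    ∑ℤ m (λ i → ∑ℤ n (λ j → f i * g j))   ∎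

  ∑ℤ-neg : ∀ n f → ∑ℤ n (λ k → f (ℤ.- k)) ≈ ∑ℤ n f
  ∑ℤ-neg n f = begin
    ∑< (suc n) (λ k → f (ℤ.- + k)) + ∑< n (λ k → f (+ suc k))
      ≈⟨ +-congʳ (∑<-suc n _) ⟩
    f (+ 0) + ∑< n (λ k → f -[1+ k ]) + ∑< n (λ k → f (+ suc k))
      ≈⟨ solve 3 (λ x y z → x :+ y :+ z := (x :+ z) :+ y) refl _ _ _ ⟩
    f (+ 0) + ∑< n (λ k → f (+ suc k)) + ∑< n (λ k → f -[1+ k ])
      ≈⟨ +-congʳ (∑<-suc n _) ⟨
    ∑ℤ n f ∎

  -- The terms at `k` and `- k` cancel. The term at 0 has a hypothesis of its own because oddness
  -- would only make its double vanish.
  ∑ℤ-antisymmetric : ∀ n f → f (+ 0) ≈ 0# → 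
                     (∀ k → k ℕ.< n → f -[1+ k ] ≈ - f (+ suc k)) → ∑ℤ n f ≈ 0#
  ∑ℤ-antisymmetric n f f0≈0 odd = begin
    ∑< (suc n) (λ k → f (+ k)) + ∑< n (λ k → f -[1+ k ])
      ≈⟨ +-congʳ (∑<-suc n _) ⟩
    f (+ 0) + ∑< n (λ k → f (+ suc k)) + ∑< n (λ k → f -[1+ k ])
      ≈⟨ +-congʳ (trans (+-congʳ f0≈0) (+-identityˡ _)) ⟩
    ∑< n (λ k → f (+ suc k)) + ∑< n (λ k → f -[1+ k ])
      ≈⟨ ∑<-+ n _ _ ⟨
    ∑< n (λ k → f (+ suc k) + f -[1+ k ])
      ≈⟨ ∑<-zero n (λ k k<n → trans (+-congˡ (odd k k<n)) (-‿inverseʳ _)) ⟩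
    0# ∎

  -- The shifted window gains the index `n + 1` and loses `- n`.
  ∑ℤ-shift₁ : ∀ n f → f (+ suc n) ≈ 0# → f (ℤ.- + n) ≈ 0# →
              ∑ℤ n (λ k → f (ℤ.suc k)) ≈ ∑ℤ n f
  ∑ℤ-shift₁ n f f⁺≈0 f⁻≈0 = begin
    ∑< (suc n) (λ k → f (+ suc k)) + ∑< n (λ k → f (ℤ.suc -[1+ k ]))
      ≈⟨ +-congˡ (∑<-cong n (λ k → reflexive (≡.cong f (suc-neg k)))) ⟩
    ∑< (suc n) (λ k → f (+ suc k)) + ∑< n (λ k → f (ℤ.- + k))
      ≈⟨ +-congˡ (trans (+-congˡ f⁻≈0) (+-identityʳ _)) ⟨
    ∑< (suc n) (λ k → f (+ suc k)) + ∑< (suc n) (λ k → f (ℤ.- + k))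
      ≈⟨ +-congˡ (∑<-suc n _) ⟩
    ∑< (suc n) (λ k → f (+ suc k)) + (f (+ 0) + ∑< n (λ k → f -[1+ k ]))
      ≈⟨ solve 3 (λ x y z → x :+ (y :+ z) := y :+ x :+ z) refl _ _ _ ⟩
    f (+ 0) + ∑< (suc n) (λ k → f (+ suc k)) + ∑< n (λ k → f -[1+ k ])
      ≈⟨ +-congʳ (∑<-suc (suc n) (λ k → f (+ k))) ⟨
    ∑< (suc (suc n)) (λ k → f (+ k)) + ∑< n (λ k → f -[1+ k ])
      ≈⟨ +-congʳ (trans (+-congˡ f⁺≈0) (+-identityʳ _)) ⟩
    ∑ℤ n f ∎
    where
    suc-neg : ∀ k → ℤ.suc -[1+ k ] ≡ ℤ.- + k
    suc-neg zero    = ≡.refl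
    suc-neg (suc k) = ≡.refl

  ∣i∣≤∣i+j∣+∣j∣ : ∀ i j → ℤ.∣ i ∣ ℕ.≤ ℤ.∣ i ℤ.+ j ∣ ℕ.+ ℤ.∣ j ∣
  ∣i∣≤∣i+j∣+∣j∣ i j = ≡.subst (λ k → ℤ.∣ k ∣ ℕ.≤ ℤ.∣ i ℤ.+ j ∣ ℕ.+ ℤ.∣ j ∣)
    (≡.trans (ℤ.+-assoc i j (ℤ.- j)) (≡.trans (≡.cong (λ k → i ℤ.+ k) (ℤ.+-inverseʳ j)) (ℤ.+-identityʳ i)))
    (ℤ.∣i-j∣≤∣i∣+∣j∣ (i ℤ.+ j) j)

  module _ {M : ℕ} where

    -- By unit steps. The bound `M + d ≤ n` serves at every stage: an index of modulus at least `n`,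
    -- moved by at most `d`, still has modulus at least `M`.
    ∑ℤ-shift⁺ : ∀ {n} f → (∀ k → M ℕ.≤ ℤ.∣ k ∣ → f k ≈ 0#) → ∀ d → M ℕ.+ d ℕ.≤ n →
                ∑ℤ n (λ k → f (k ℤ.+ + d)) ≈ ∑ℤ n f
    ∑ℤ-shift⁺ {n} f f≈0 zero    _ =
      ∑ℤ-cong n (λ k → reflexive (≡.cong f (ℤ.+-identityʳ k)))
    ∑ℤ-shift⁺ {n} f f≈0 (suc d) M+1+d≤n = begin
      ∑ℤ n (λ k → f (k ℤ.+ + suc d))
        ≈⟨ ∑ℤ-cong n (λ k → reflexive (≡.cong f (comm k))) ⟩
      ∑ℤ n (λ k → f (ℤ.suc k ℤ.+ + d))
        ≈⟨ ∑ℤ-shift₁ n (λ k → f (k ℤ.+ + d)) (vanish (+ suc n) (ℕ.n≤1+n n))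
             (vanish (ℤ.- + n) (ℕ.≤-reflexive (≡.sym (ℤ.∣-i∣≡∣i∣ (+ n))))) ⟩
      ∑ℤ n (λ k → f (k ℤ.+ + d))
        ≈⟨ ∑ℤ-shift⁺ f f≈0 d M+d≤n ⟩
      ∑ℤ n f ∎
      where
      M+d≤n : M ℕ.+ d ℕ.≤ n
      M+d≤n = ℕ.≤-trans (ℕ.+-monoʳ-≤ M (ℕ.n≤1+n d)) M+1+d≤n
      comm : ∀ k → k ℤ.+ + suc d ≡ ℤ.suc k ℤ.+ + d
      comm k = ≡.trans (≡.sym (ℤ.+-assoc k (+ 1) (+ d))) (≡.cong (λ i → i ℤ.+ + d) (ℤ.+-comm k (+ 1)))
      vanish : ∀ k → n ℕ.≤ ℤ.∣ k ∣ → f (k ℤ.+ + d) ≈ 0#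
      vanish k n≤∣k∣ = f≈0 _ (ℕ.+-cancelʳ-≤ d _ _
        (ℕ.≤-trans M+d≤n (ℕ.≤-trans n≤∣k∣ (∣i∣≤∣i+j∣+∣j∣ k (+ d)))))

    ∑ℤ-shift : ∀ {n} f → (∀ k → M ℕ.≤ ℤ.∣ k ∣ → f k ≈ 0#) → ∀ d → M ℕ.+ ℤ.∣ d ∣ ℕ.≤ n →
               ∑ℤ n (λ k → f (k ℤ.+ d)) ≈ ∑ℤ n f
    ∑ℤ-shift     f f≈0 (+ d)    M+d≤n = ∑ℤ-shift⁺ f f≈0 d M+d≤n
    ∑ℤ-shift {n} f f≈0 -[1+ d ] M+d≤n = begin
      ∑ℤ n (λ k → f (k ℤ.+ -[1+ d ]))
        ≈⟨ ∑ℤ-neg n (λ k → f (k ℤ.+ -[1+ d ])) ⟨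
      ∑ℤ n (λ k → f (ℤ.- k ℤ.+ -[1+ d ]))
        ≈⟨ ∑ℤ-cong n (λ k → reflexive (≡.cong f (ℤ.neg-distrib-+ k (+ suc d)))) ⟨
      ∑ℤ n (λ k → f (ℤ.- (k ℤ.+ + suc d)))
        ≈⟨ ∑ℤ-shift⁺ (λ k → f (ℤ.- k)) (λ k M≤∣k∣ → f≈0 (ℤ.- k)
            (ℕ.≤-trans M≤∣k∣ (ℕ.≤-reflexive (≡.sym (ℤ.∣-i∣≡∣i∣ k))))) (suc d) M+d≤n ⟩
      ∑ℤ n (λ k → f (ℤ.- k))
        ≈⟨ ∑ℤ-neg n f ⟩
      ∑ℤ n f ∎

-- Coefficients of finite sums of series.

module SeriesSums {c ℓ} (R : CommutativeRing c ℓ) (N : ℕ) where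

  open import Relation.Binary.PropositionalEquality.Core using (_≡_; refl; cong; cong₂)

  open CommutativeRing R using (_+_)
  open IntervalSums R
  open TruncatedSeries R N
  private module S = IntervalSums truncatedSeries

  ∑<-coefficient : ∀ n (f : ℕ → Series) i → S.∑< n f i ≡ ∑< n (λ k → f k i)
  ∑<-coefficient zero    f i = refl
  ∑<-coefficient (suc n) f i = cong (λ x → x + f n i) (∑<-coefficient n f i)

  ∑ℤ-coefficient : ∀ n (f : ℤ → Series) i → S.∑ℤ n f i ≡ ∑ℤ n (λ k → f k i)
  ∑ℤ-coefficient n f i = cong₂ _+_ (∑<-coefficient (suc n) (λ k → f (+ k)) i)
                                   (∑<-coefficient n (λ k → f -[1+ k ]) i)

-- Exponents of the theta series, and the lattice that carries the involution.

module ThetaExponents where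

  open import Data.Integer.Tactic.RingSolver using (solve-∀)
  open import Data.Nat.Base using (_/_)
  import Data.Nat.DivMod as ℕ
  open import Relation.Binary.PropositionalEquality

  -- k(3k + 1)/2
  pentagonal : ℤ → ℕ
  pentagonal (+ zero)      = 0
  pentagonal (+ suc n)     = pentagonal (+ n) ℕ.+ (2 ℕ.+ 3 ℕ.* n)
  pentagonal -[1+ zero ]   = 1
  pentagonal -[1+ suc n ]  = pentagonal -[1+ n ] ℕ.+ (4 ℕ.+ 3 ℕ.* n)

  triangular : ℕ → ℕ
  triangular zero    = 0
  triangular (suc n) = triangular n ℕ.+ suc n

  -- k(2k + 1)
  hexagonal : ℤ → ℕ
  hexagonal (+ n)    = triangular (n ℕ.+ n)
  hexagonal -[1+ n ] = triangular (suc (n ℕ.+ n))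

  alternating : ℕ → ℤ
  alternating zero    = + 1
  alternating (suc n) = ℤ.- alternating n

  open ≡-Reasoning

  pos-distrib : ∀ a b c d → + (a ℕ.+ (b ℕ.+ c ℕ.* d)) ≡ + a ℤ.+ (+ b ℤ.+ + c ℤ.* + d)
  pos-distrib a b c d = cong (λ x → + a ℤ.+ (+ b ℤ.+ x)) (ℤ.pos-* c d)

  double-+ : ∀ a i {j} → + 2 ℤ.* + a ≡ j → + 2 ℤ.* (+ a ℤ.+ i) ≡ j ℤ.+ + 2 ℤ.* i
  double-+ a i eq = trans (ℤ.*-distribˡ-+ (+ 2) (+ a) i) (cong (λ k → k ℤ.+ + 2 ℤ.* i) eq)

  -- Doubling clears the denominator, so that each step of the recursion is a polynomial identity
  -- over ℤ.
  pentagonal-double : ∀ k → + 2 ℤ.* + pentagonal k ≡ k ℤ.* (+ 3 ℤ.* k ℤ.+ + 1)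
  pentagonal-double (+ zero) = refl
  pentagonal-double (+ suc n) = begin
    + 2 ℤ.* + (pentagonal (+ n) ℕ.+ (2 ℕ.+ 3 ℕ.* n))
      ≡⟨ cong (+ 2 ℤ.*_) (pos-distrib (pentagonal (+ n)) 2 3 n) ⟩
    + 2 ℤ.* (+ pentagonal (+ n) ℤ.+ (+ 2 ℤ.+ + 3 ℤ.* + n))
      ≡⟨ double-+ (pentagonal (+ n)) (+ 2 ℤ.+ + 3 ℤ.* + n) (pentagonal-double (+ n)) ⟩
    + n ℤ.* (+ 3 ℤ.* + n ℤ.+ + 1) ℤ.+ + 2 ℤ.* (+ 2 ℤ.+ + 3 ℤ.* + n)
      ≡⟨ step (+ n) ⟩
    (+ 1 ℤ.+ + n) ℤ.* (+ 3 ℤ.* (+ 1 ℤ.+ + n) ℤ.+ + 1) ∎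
    where
    step : ∀ n → n ℤ.* (+ 3 ℤ.* n ℤ.+ + 1) ℤ.+ + 2 ℤ.* (+ 2 ℤ.+ + 3 ℤ.* n)
               ≡ (+ 1 ℤ.+ n) ℤ.* (+ 3 ℤ.* (+ 1 ℤ.+ n) ℤ.+ + 1)
    step = solve-∀
  pentagonal-double -[1+ zero ] = refl
  pentagonal-double -[1+ suc n ] = begin
    + 2 ℤ.* + (pentagonal -[1+ n ] ℕ.+ (4 ℕ.+ 3 ℕ.* n))
      ≡⟨ cong (+ 2 ℤ.*_) (pos-distrib (pentagonal -[1+ n ]) 4 3 n) ⟩
    + 2 ℤ.* (+ pentagonal -[1+ n ] ℤ.+ (+ 4 ℤ.+ + 3 ℤ.* + n))
      ≡⟨ double-+ (pentagonal -[1+ n ]) (+ 4 ℤ.+ + 3 ℤ.* + n) (pentagonal-double -[1+ n ]) ⟩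
    -[1+ n ] ℤ.* (+ 3 ℤ.* -[1+ n ] ℤ.+ + 1) ℤ.+ + 2 ℤ.* (+ 4 ℤ.+ + 3 ℤ.* + n)
      ≡⟨ step (+ n) ⟩
    -[1+ suc n ] ℤ.* (+ 3 ℤ.* -[1+ suc n ] ℤ.+ + 1) ∎
    where
    step : ∀ n → ℤ.- (+ 1 ℤ.+ n) ℤ.* (+ 3 ℤ.* ℤ.- (+ 1 ℤ.+ n) ℤ.+ + 1) ℤ.+ + 2 ℤ.* (+ 4 ℤ.+ + 3 ℤ.* n)
               ≡ ℤ.- (+ 2 ℤ.+ n) ℤ.* (+ 3 ℤ.* ℤ.- (+ 2 ℤ.+ n) ℤ.+ + 1)
    step = solve-∀

  triangular-double : ∀ n → + 2 ℤ.* + triangular n ≡ + n ℤ.* (+ n ℤ.+ + 1)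
  triangular-double zero = refl
  triangular-double (suc n) = begin
    + 2 ℤ.* (+ triangular n ℤ.+ (+ 1 ℤ.+ + n))
      ≡⟨ double-+ (triangular n) (+ 1 ℤ.+ + n) (triangular-double n) ⟩
    + n ℤ.* (+ n ℤ.+ + 1) ℤ.+ + 2 ℤ.* (+ 1 ℤ.+ + n)
      ≡⟨ step (+ n) ⟩
    (+ 1 ℤ.+ + n) ℤ.* (+ 1 ℤ.+ + n ℤ.+ + 1) ∎
    where
    step : ∀ n → n ℤ.* (n ℤ.+ + 1) ℤ.+ + 2 ℤ.* (+ 1 ℤ.+ n)
               ≡ (+ 1 ℤ.+ n) ℤ.* (+ 1 ℤ.+ n ℤ.+ + 1)
    step = solve-∀

  -- `n(n + 1)` is unchanged by `n ↦ -1 - n`, so `k(2k + 1)` is the triangular number of index `2k`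
  -- for `k ≥ 0` and of index `-2k - 1` for `k < 0`. Thus `hexagonal` meets every triangular index
  -- exactly once.
  hexagonal-double : ∀ k → + 2 ℤ.* + hexagonal k ≡ + 2 ℤ.* k ℤ.* (+ 2 ℤ.* k ℤ.+ + 1)
  hexagonal-double (+ n) = trans (triangular-double (n ℕ.+ n)) (step (+ n))
    where
    step : ∀ n → (n ℤ.+ n) ℤ.* (n ℤ.+ n ℤ.+ + 1) ≡ + 2 ℤ.* n ℤ.* (+ 2 ℤ.* n ℤ.+ + 1)
    step = solve-∀
  hexagonal-double -[1+ n ] = trans (triangular-double (suc (n ℕ.+ n))) (step (+ n))
    where
    step : ∀ n → (+ 1 ℤ.+ (n ℤ.+ n)) ℤ.* (+ 1 ℤ.+ (n ℤ.+ n) ℤ.+ + 1)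
               ≡ + 2 ℤ.* ℤ.- (+ 1 ℤ.+ n) ℤ.* (+ 2 ℤ.* ℤ.- (+ 1 ℤ.+ n) ℤ.+ + 1)
    step = solve-∀

  ∣k∣≤pentagonal : ∀ k → ∣ k ∣ ℕ.≤ pentagonal k
  ∣k∣≤pentagonal (+ zero)     = z≤n
  ∣k∣≤pentagonal (+ suc n)    = ℕ.≤-trans (ℕ.≤-reflexive (ℕ.+-comm 1 n))
    (ℕ.+-mono-≤ (∣k∣≤pentagonal (+ n)) (s≤s z≤n))
  ∣k∣≤pentagonal -[1+ zero ]  = ℕ.≤-refl
  ∣k∣≤pentagonal -[1+ suc n ] = ℕ.≤-trans (ℕ.≤-reflexive (ℕ.+-comm 1 (suc n)))
    (ℕ.+-mono-≤ (∣k∣≤pentagonal -[1+ n ]) (s≤s z≤n))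

  n≤triangular : ∀ n → n ℕ.≤ triangular n
  n≤triangular zero    = z≤n
  n≤triangular (suc n) = ℕ.m≤n+m (suc n) (triangular n)

  ∣k∣≤hexagonal : ∀ k → ∣ k ∣ ℕ.≤ hexagonal k
  ∣k∣≤hexagonal (+ n)    = ℕ.≤-trans (ℕ.m≤m+n n n) (n≤triangular (n ℕ.+ n))
  ∣k∣≤hexagonal -[1+ n ] = ℕ.≤-trans (s≤s (ℕ.m≤m+n n n)) (n≤triangular (suc (n ℕ.+ n)))

  -- The half `l` comes with the bound that later controls a shift by `3l`, and with the value of
  -- the sign (-1)ᵏ.
  data Parity (k : ℤ) : Set where
    even : ∀ l → k ≡ l ℤ.+ l → ∣ l ∣ ℕ.≤ ∣ k ∣ → alternating ∣ k ∣ ≡ + 1 → Parity k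
    odd  : ∀ l → k ≡ + 1 ℤ.+ (l ℤ.+ l) → ∣ l ∣ ℕ.≤ ∣ k ∣ → alternating ∣ k ∣ ≡ ℤ.- + 1 → Parity k

  parity : ∀ k → Parity k
  parity (+ zero)     = even (+ 0) refl z≤n refl
  parity (+ suc n) with parity (+ n)
  ... | even l eq l≤n alt = odd l (cong ℤ.suc eq) (ℕ.m≤n⇒m≤1+n l≤n) (cong ℤ.-_ alt)
  ... | odd l eq l≤n alt  = even (+ 1 ℤ.+ l) (trans (cong ℤ.suc eq) (step l))
    (ℕ.≤-trans (ℤ.∣i+j∣≤∣i∣+∣j∣ (+ 1) l) (s≤s l≤n)) (cong ℤ.-_ alt)
    where
    step : ∀ l → + 1 ℤ.+ (+ 1 ℤ.+ (l ℤ.+ l)) ≡ + 1 ℤ.+ l ℤ.+ (+ 1 ℤ.+ l)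
    step = solve-∀
  parity -[1+ zero ]  = odd -[1+ 0 ] refl ℕ.≤-refl refl
  parity -[1+ suc n ] with parity -[1+ n ]
  ... | even l eq l≤n alt = odd (l ℤ.- + 1) (trans (cong ℤ.pred eq) (step l))
    (ℕ.≤-trans (ℤ.∣i-j∣≤∣i∣+∣j∣ l (+ 1)) (ℕ.≤-trans (ℕ.+-monoˡ-≤ 1 l≤n) (ℕ.≤-reflexive (ℕ.+-comm _ 1)))) (cong ℤ.-_ alt)
    where
    step : ∀ l → ℤ.- + 1 ℤ.+ (l ℤ.+ l) ≡ + 1 ℤ.+ (l ℤ.- + 1 ℤ.+ (l ℤ.- + 1))
    step = solve-∀
  ... | odd l eq l≤n alt  = even l (trans (cong ℤ.pred eq) (step l)) (ℕ.m≤n⇒m≤1+n l≤n) (cong ℤ.-_ alt)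
    where
    step : ∀ l → ℤ.- + 1 ℤ.+ (+ 1 ℤ.+ (l ℤ.+ l)) ≡ l ℤ.+ l
    step = solve-∀

  -- Recovers a natural number from its double, so that `latticeExponent` can be a plain quotient
  -- and its invariance can be read off from `lattice`.
  half : ∀ a {i} → + 2 ℤ.* + a ≡ i → a ≡ ∣ i ∣ / 2
  half a {i} eq = begin
    a                        ≡⟨ ℕ.m*n/n≡m a 2 ⟨
    a ℕ.* 2 / 2              ≡⟨ cong (_/ 2) (ℕ.*-comm a 2) ⟩
    2 ℕ.* a / 2              ≡⟨ cong (_/ 2) (ℤ.abs-* (+ 2) (+ a)) ⟨
    ∣ + 2 ℤ.* + a ∣ / 2      ≡⟨ cong (λ j → ∣ j ∣ / 2) eq ⟩
    ∣ i ∣ / 2                ∎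

  -- Twice k(3k + 1)/2 + s(2s + 1), where s = t + 3l for k = 2l and s = - t - 3l - 2 for k = 2l + 1.
  -- These substitutions turn the coefficient (-1)ᵏ (4s + 1) - (6k + 1) into 4t, which is odd
  -- under the involution (k , t) ↦ (k + t , - t), whereas 2k + t and t² are invariant.
  lattice : ℤ → ℤ → ℤ
  lattice k t = + 3 ℤ.* c ℤ.* c ℤ.+ + 2 ℤ.* c ℤ.+ t ℤ.* t
    where c = k ℤ.+ k ℤ.+ t

  latticeExponent : ℤ → ℤ → ℕ
  latticeExponent k t = ∣ lattice k t ∣ / 2

  latticeExponent-involution : ∀ k t → latticeExponent (k ℤ.+ t) (ℤ.- t) ≡ latticeExponent k t
  latticeExponent-involution k t = cong (λ i → ∣ i ∣ / 2) (invariant k t)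
    where
    invariant : ∀ k t → + 3 ℤ.* (k ℤ.+ t ℤ.+ (k ℤ.+ t) ℤ.+ ℤ.- t) ℤ.* (k ℤ.+ t ℤ.+ (k ℤ.+ t) ℤ.+ ℤ.- t)
                        ℤ.+ + 2 ℤ.* (k ℤ.+ t ℤ.+ (k ℤ.+ t) ℤ.+ ℤ.- t) ℤ.+ ℤ.- t ℤ.* ℤ.- t
                      ≡ + 3 ℤ.* (k ℤ.+ k ℤ.+ t) ℤ.* (k ℤ.+ k ℤ.+ t) ℤ.+ + 2 ℤ.* (k ℤ.+ k ℤ.+ t) ℤ.+ t ℤ.* t
    invariant = solve-∀

  double-sum : ∀ k s → + 2 ℤ.* (+ pentagonal k ℤ.+ + hexagonal s)
             ≡ k ℤ.* (+ 3 ℤ.* k ℤ.+ + 1) ℤ.+ + 2 ℤ.* s ℤ.* (+ 2 ℤ.* s ℤ.+ + 1)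
  double-sum k s = trans (double-+ (pentagonal k) (+ hexagonal s) (pentagonal-double k))
    (cong (λ i → k ℤ.* (+ 3 ℤ.* k ℤ.+ + 1) ℤ.+ i) (hexagonal-double s))

  latticeExponent-even : ∀ l t → pentagonal (l ℤ.+ l) ℕ.+ hexagonal (t ℤ.+ + 3 ℤ.* l)
                               ≡ latticeExponent (l ℤ.+ l) t
  latticeExponent-even l t = half _ (trans (double-sum (l ℤ.+ l) (t ℤ.+ + 3 ℤ.* l)) (step l t))
    where
    step : ∀ l t →
      (l ℤ.+ l) ℤ.* (+ 3 ℤ.* (l ℤ.+ l) ℤ.+ + 1)
        ℤ.+ + 2 ℤ.* (t ℤ.+ + 3 ℤ.* l) ℤ.* (+ 2 ℤ.* (t ℤ.+ + 3 ℤ.* l) ℤ.+ + 1)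
      ≡ + 3 ℤ.* (l ℤ.+ l ℤ.+ (l ℤ.+ l) ℤ.+ t) ℤ.* (l ℤ.+ l ℤ.+ (l ℤ.+ l) ℤ.+ t)
        ℤ.+ + 2 ℤ.* (l ℤ.+ l ℤ.+ (l ℤ.+ l) ℤ.+ t) ℤ.+ t ℤ.* t
    step = solve-∀

  latticeExponent-odd : ∀ l t →
    pentagonal (+ 1 ℤ.+ (l ℤ.+ l)) ℕ.+ hexagonal (ℤ.- (t ℤ.+ (+ 2 ℤ.+ + 3 ℤ.* l)))
      ≡ latticeExponent (+ 1 ℤ.+ (l ℤ.+ l)) t
  latticeExponent-odd l t = half _
    (trans (double-sum (+ 1 ℤ.+ (l ℤ.+ l)) (ℤ.- (t ℤ.+ (+ 2 ℤ.+ + 3 ℤ.* l)))) (step l t))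
    where
    step : ∀ l t →
      (+ 1 ℤ.+ (l ℤ.+ l)) ℤ.* (+ 3 ℤ.* (+ 1 ℤ.+ (l ℤ.+ l)) ℤ.+ + 1)
        ℤ.+ + 2 ℤ.* ℤ.- (t ℤ.+ (+ 2 ℤ.+ + 3 ℤ.* l)) ℤ.* (+ 2 ℤ.* ℤ.- (t ℤ.+ (+ 2 ℤ.+ + 3 ℤ.* l)) ℤ.+ + 1)
      ≡ + 3 ℤ.* (+ 1 ℤ.+ (l ℤ.+ l) ℤ.+ (+ 1 ℤ.+ (l ℤ.+ l)) ℤ.+ t) ℤ.* (+ 1 ℤ.+ (l ℤ.+ l) ℤ.+ (+ 1 ℤ.+ (l ℤ.+ l)) ℤ.+ t)
        ℤ.+ + 2 ℤ.* (+ 1 ℤ.+ (l ℤ.+ l) ℤ.+ (+ 1 ℤ.+ (l ℤ.+ l)) ℤ.+ t) ℤ.+ t ℤ.* t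
    step = solve-∀

  -- The lattice exponent is `pentagonal k` plus some hexagonal number. Hence lattice terms with
  -- large `k` vanish uniformly in `t`.
  pentagonal≤latticeExponent : ∀ k t → pentagonal k ℕ.≤ latticeExponent k t
  pentagonal≤latticeExponent k t with parity k
  ... | even l refl _ _ = ℕ.≤-trans (ℕ.m≤m+n _ _) (ℕ.≤-reflexive (latticeExponent-even l t))
  ... | odd l refl _ _  = ℕ.≤-trans (ℕ.m≤m+n _ _) (ℕ.≤-reflexive (latticeExponent-odd l t))

  -- A bound for the summation index beyond which all terms of the theta series
  -- vanish modulo qᴹ, with room for the index shifts of the lattice involution.
  cutoff : ℕ → ℕ
  cutoff M = M ℕ.+ (M ℕ.+ (2 ℕ.+ 3 ℕ.* M))

-- The finite triple product with Gaussian binomials, and its limit for nilpotent `q`.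

module JacobiTripleProduct {c ℓ} (R : CommutativeRing c ℓ) (q : CommutativeRing.Carrier R) where

  open import Data.Product.Base using (∃; _,_; proj₁; proj₂)

  open CommutativeRing R hiding (zero)
  open import Algebra.Properties.Semiring.Exp semiring
  open import Relation.Binary.Reasoning.Setoid setoid
  open IntegerMultiples R using (solve; _:+_; _:*_; _:-_; :-_; con; _:=_)
  open AntidiagonalSums R
  open IntervalSums R

  -- The `q`-Pochhammer symbol `(-u; q)ₙ`; all signs enter through `u`.
  poch : Carrier → ℕ → Carrier
  poch u zero    = 1#
  poch u (suc n) = poch u n * (1# + u * q ^ n)

  -- (1 - q)(1 - q²) ⋯ (1 - qⁿ)
  euler : ℕ → Carrier
  euler = poch (- q)

  -- The Gaussian binomial coefficient of i + j over j.
  gauss : ℕ → ℕ → Carrier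
  gauss zero    j       = 1#
  gauss (suc i) zero    = 1#
  gauss (suc i) (suc j) = gauss i (suc j) + q ^ suc i * gauss (suc i) j

  -- uᵏ q^(k(k-1)/2)
  tri : Carrier → ℕ → Carrier
  tri u zero    = 1#
  tri u (suc k) = tri u k * (u * q ^ k)

  -- For uv = q this is uᵏ q^(k(k-1)/2) with k = m - n of either sign.
  term : Carrier → Carrier → ℕ → ℕ → Carrier
  term u v zero    n       = tri v n
  term u v (suc m) zero    = tri u (suc m)
  term u v (suc m) (suc n) = term u v m n

  poch-cong : ∀ {u v} → u ≈ v → ∀ n → poch u n ≈ poch v n
  poch-cong u≈v zero    = refl
  poch-cong u≈v (suc n) = *-cong (poch-cong u≈v n) (+-congˡ (*-congʳ u≈v))

  poch-suc : ∀ u n → poch u (suc n) ≈ (1# + u) * poch (u * q) n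
  poch-suc u zero    = solve 1 (λ u → con (+ 1) :* (con (+ 1) :+ u :* con (+ 1))
                                   := (con (+ 1) :+ u) :* con (+ 1)) refl u
  poch-suc u (suc n) = begin
    poch u (suc n) * (1# + u * (q * q ^ n))                  ≈⟨ *-congʳ (poch-suc u n) ⟩
    (1# + u) * poch (u * q) n * (1# + u * (q * q ^ n))       ≈⟨ *-congˡ (+-congˡ (*-assoc u q _)) ⟨
    (1# + u) * poch (u * q) n * (1# + u * q * q ^ n)         ≈⟨ *-assoc _ _ _ ⟩
    (1# + u) * poch (u * q) (suc n)                          ∎

  GeometricInverses : (ℕ → Carrier) → Set ℓ
  GeometricInverses g = ∀ i → g i * (1# - q ^ suc i) ≈ 1#

  euler-factor : ∀ n → 1# + - q * q ^ n ≈ 1# - q ^ suc n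
  euler-factor n = solve 2 (λ x y → con (+ 1) :+ :- x :* y := con (+ 1) :- x :* y) refl q (q ^ n)

  euler-suc : ∀ {n} → q ^ suc n ≈ 0# → euler (suc n) ≈ euler n
  euler-suc {n} qⁿ⁺¹≈0 = begin
    euler n * (1# + - q * q ^ n)
      ≈⟨ *-congˡ (euler-factor n) ⟩
    euler n * (1# - q ^ suc n)
      ≈⟨ *-congˡ (+-congˡ (-‿cong qⁿ⁺¹≈0)) ⟩
    euler n * (1# - 0#)
      ≈⟨ solve 1 (λ e → e :* (con (+ 1) :- con (+ 0)) := e) refl _ ⟩
    euler n ∎

  geometric : Carrier → ℕ → Carrier
  geometric x n = ∑< n (x ^_)

  geometric-* : ∀ x n → geometric x n * (1# - x) ≈ 1# - x ^ n
  geometric-* x zero    = trans (zeroˡ _) (sym (-‿inverseʳ 1#))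
  geometric-* x (suc n) = begin
    (geometric x n + x ^ n) * (1# - x)
      ≈⟨ distribʳ _ _ _ ⟩
    geometric x n * (1# - x) + x ^ n * (1# - x)
      ≈⟨ +-congʳ (geometric-* x n) ⟩
    1# - x ^ n + x ^ n * (1# - x)
      ≈⟨ solve 2 (λ x y → con (+ 1) :- y :+ y :* (con (+ 1) :- x) := con (+ 1) :- x :* y) refl x (x ^ n) ⟩
    1# - x ^ suc n ∎

  gauss-zeroʳ : ∀ i → gauss i 0 ≈ 1#
  gauss-zeroʳ zero    = refl
  gauss-zeroʳ (suc i) = refl

  -- The second `q`-Pascal rule, mirror image of the defining one. Having both rules gives the
  -- symmetry `gauss-comm`.
  gauss-pascal : ∀ i j → gauss (suc i) (suc j) ≈ gauss (suc i) j + q ^ suc j * gauss i (suc j)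
  gauss-pascal zero zero = refl
  gauss-pascal zero (suc j) = begin
    1# + q ^ 1 * gauss 1 (suc j)
      ≈⟨ +-congˡ (*-congˡ (gauss-pascal zero j)) ⟩
    1# + q ^ 1 * (gauss 1 j + q ^ suc j * 1#)
      ≈⟨ solve 3 (λ x g y → con (+ 1) :+ x :* con (+ 1) :* (g :+ x :* y :* con (+ 1))
                         := con (+ 1) :+ x :* con (+ 1) :* g :+ x :* (x :* y) :* con (+ 1))
           refl q (gauss 1 j) (q ^ j) ⟩
    1# + q ^ 1 * gauss 1 j + q ^ suc (suc j) * 1# ∎
  gauss-pascal (suc i) zero = begin
    gauss (suc i) 1 + q ^ suc (suc i) * 1#
      ≈⟨ +-congʳ (gauss-pascal i zero) ⟩
    1# + q ^ 1 * gauss i 1 + q ^ suc (suc i) * 1#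
      ≈⟨ solve 3 (λ x g y → con (+ 1) :+ x :* con (+ 1) :* g :+ x :* (x :* y) :* con (+ 1)
                         := con (+ 1) :+ x :* con (+ 1) :* (g :+ x :* y :* con (+ 1)))
           refl q (gauss i 1) (q ^ i) ⟩
    1# + q ^ 1 * gauss (suc i) 1 ∎
  gauss-pascal (suc i) (suc j) = begin
    gauss (suc i) (suc (suc j)) + q ^ suc (suc i) * gauss (suc (suc i)) (suc j)
      ≈⟨ +-cong (gauss-pascal i (suc j)) (*-congˡ (gauss-pascal (suc i) j)) ⟩
    gauss (suc i) (suc j) + q ^ suc (suc j) * gauss i (suc (suc j))
      + q ^ suc (suc i) * (gauss (suc (suc i)) j + q ^ suc j * gauss (suc i) (suc j))
      ≈⟨ solve 6 (λ x y z g h k →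
             g :+ x :* (x :* z) :* h :+ x :* (x :* y) :* (k :+ x :* z :* g)
          := g :+ x :* (x :* y) :* k :+ x :* (x :* z) :* (h :+ x :* y :* g))
           refl q (q ^ i) (q ^ j) _ _ _ ⟩
    gauss (suc i) (suc j) + q ^ suc (suc i) * gauss (suc (suc i)) j
      + q ^ suc (suc j) * (gauss i (suc (suc j)) + q ^ suc i * gauss (suc i) (suc j)) ∎

  gauss-comm : ∀ i j → gauss i j ≈ gauss j i
  gauss-comm zero    j       = sym (gauss-zeroʳ j)
  gauss-comm (suc i) zero    = refl
  gauss-comm (suc i) (suc j) =
    trans (+-cong (gauss-comm i (suc j)) (*-congˡ (gauss-comm (suc i) j)))
          (sym (gauss-pascal j i))

  -- The quotient formula for Gaussian binomials with its denominators cleared.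
  gauss-*-euler : ∀ i j → gauss i j * (euler i * euler j) ≈ euler (i ℕ.+ j)
  gauss-*-euler zero j = trans (*-identityˡ _) (*-identityˡ _)
  gauss-*-euler (suc i) zero rewrite ℕ.+-identityʳ i = trans (*-identityˡ _) (*-identityʳ _)
  gauss-*-euler (suc i) (suc j) = begin
    (gauss i (suc j) + q ^ suc i * gauss (suc i) j)
      * (euler i * (1# + - q * q ^ i) * (euler j * (1# + - q * q ^ j)))
      ≈⟨ solve 7 (λ x y z g h a b →
             (g :+ x :* y :* h) :* (a :* (con (+ 1) :+ :- x :* y) :* (b :* (con (+ 1) :+ :- x :* z)))
          := g :* (a :* (b :* (con (+ 1) :+ :- x :* z))) :* (con (+ 1) :+ :- x :* y)
             :+ h :* (a :* (con (+ 1) :+ :- x :* y) :* b) :* (x :* y :* (con (+ 1) :+ :- x :* z)))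
           refl q (q ^ i) (q ^ j) _ _ _ _ ⟩
    gauss i (suc j) * (euler i * euler (suc j)) * (1# + - q * q ^ i)
      + gauss (suc i) j * (euler (suc i) * euler j) * (q ^ suc i * (1# + - q * q ^ j))
      ≈⟨ +-cong (*-congʳ (gauss-*-euler i (suc j))) (*-congʳ (gauss-*-euler (suc i) j)) ⟩
    euler (i ℕ.+ suc j) * (1# + - q * q ^ i)
      + euler (suc i ℕ.+ j) * (q ^ suc i * (1# + - q * q ^ j))
      ≈⟨ +-congʳ (*-congʳ (reflexive (≡.cong euler (ℕ.+-suc i j)))) ⟩
    euler (suc i ℕ.+ j) * (1# + - q * q ^ i)
      + euler (suc i ℕ.+ j) * (q ^ suc i * (1# + - q * q ^ j))
      ≈⟨ solve 4 (λ e x y z →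
             e :* (con (+ 1) :+ :- x :* y) :+ e :* (x :* y :* (con (+ 1) :+ :- x :* z))
          := e :* (con (+ 1) :+ :- x :* (x :* (y :* z))))
           refl _ q (q ^ i) (q ^ j) ⟩
    euler (suc i ℕ.+ j) * (1# + - q * (q * (q ^ i * q ^ j)))
      ≈⟨ *-congˡ (+-congˡ (*-congˡ (*-congˡ (^-homo-* q i j)))) ⟨
    euler (suc i ℕ.+ j) * (1# + - q * q ^ (suc i ℕ.+ j))
      ≡⟨ ≡.cong euler (ℕ.+-suc (suc i) j) ⟨
    euler (suc i ℕ.+ suc j) ∎

  module _ {u v : Carrier} (uv≈q : u * v ≈ q) where

    -- With `k = j - b` the ratio of consecutive terms is `u qᵏ`. Here `k = a - i`, and
    -- multiplication by `qⁱ` removes the negative powers of `q`.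
    term-suc : ∀ i j a b → i ℕ.+ j ≡ a ℕ.+ b →
               u * q ^ a * term u v j b ≈ q ^ i * term u v (suc j) b
    term-suc i zero a zero i≡a
      rewrite ℕ.+-identityʳ i | ℕ.+-identityʳ a | i≡a =
      solve 2 (λ u x → u :* x :* con (+ 1) := x :* (con (+ 1) :* (u :* con (+ 1)))) refl u (q ^ a)
    term-suc i zero a (suc b) i≡a+b
      rewrite ℕ.+-identityʳ i | i≡a+b | ℕ.+-suc a b = begin
      u * q ^ a * (tri v b * (v * q ^ b))
        ≈⟨ solve 5 (λ u v x y t → u :* x :* (t :* (v :* y)) := u :* v :* (x :* y) :* t) refl _ _ _ _ _ ⟩
      u * v * (q ^ a * q ^ b) * tri v b
        ≈⟨ *-congʳ (*-cong uv≈q (sym (^-homo-* q a b))) ⟩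
      q * q ^ (a ℕ.+ b) * tri v b ∎
    term-suc i (suc j) a zero i+j≡a
      rewrite ℕ.+-identityʳ a | ≡.sym i+j≡a = begin
      u * q ^ (i ℕ.+ suc j) * tri u (suc j)
        ≈⟨ *-congʳ (*-congˡ (^-homo-* q i (suc j))) ⟩
      u * (q ^ i * q ^ suc j) * tri u (suc j)
        ≈⟨ solve 4 (λ u x y t → u :* (x :* y) :* t := x :* (t :* (u :* y))) refl _ _ _ _ ⟩
      q ^ i * tri u (suc (suc j)) ∎
    term-suc i (suc j) a (suc b) eq = term-suc i j a b
      (ℕ.suc-injective (≡.trans (≡.sym (ℕ.+-suc i j)) (≡.trans eq (ℕ.+-suc a b))))

  -- Reflection `k ↦ - k` exchanges `u` and `v`; the hypothesis says `i - b = - (j - a)`.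
  term-swap : ∀ u v i j a b → i ℕ.+ j ≡ a ℕ.+ b → term u v i b ≡ term v u j a
  term-swap u v zero j a b ≡.refl = ≡.sym (term-+ a b)
    where
    term-+ : ∀ a b → term v u (a ℕ.+ b) a ≡ tri v b
    term-+ zero    zero    = ≡.refl
    term-+ zero    (suc b) = ≡.refl
    term-+ (suc a) b       = term-+ a b
  term-swap u v (suc i) j a zero eq
    rewrite ℕ.+-identityʳ a | ≡.sym eq = ≡.sym (term-∸ i j)
    where
    term-∸ : ∀ i j → term v u j (suc i ℕ.+ j) ≡ tri u (suc i)
    term-∸ i zero    rewrite ℕ.+-identityʳ i = ≡.refl
    term-∸ i (suc j) rewrite ℕ.+-suc i j     = term-∸ i j
  term-swap u v (suc i) j a (suc b) eq =
    term-swap u v i j a b (ℕ.suc-injective (≡.trans eq (ℕ.+-suc a b)))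

  -- For uv = q, the finite form of the triple product: the sum of gauss (a - k) (b + k) uᵏ q^(k(k-1)/2)
  -- over - b ≤ k ≤ a.  Each step a ↦ a + 1 multiplies it by 1 + uqᵃ.
  gaussSum : Carrier → Carrier → ℕ → ℕ → Carrier
  gaussSum u v a b = ∑ (a ℕ.+ b) (λ i j → gauss i j * term u v j b)

  -- The defining `q`-Pascal rule splits each coefficient in two. The first parts add up to the old
  -- sum, and by `term-suc` the second parts add up to `u qᵃ` times it.
  gaussSum-suc : ∀ {u v} → u * v ≈ q → ∀ a b →
                 gaussSum u v (suc a) b ≈ gaussSum u v a b * (1# + u * q ^ a)
  gaussSum-suc {u} {v} uv≈q a b = begin
    ∑ (suc m) (λ i j → gauss i j * t j)
      ≈⟨ ∑-last m (λ i j → gauss i j * t j) ⟩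
    gauss (suc m) 0 * t 0 + ∑ m (λ i j → gauss i (suc j) * t (suc j))
      ≈⟨ +-congˡ (∑-cong m (λ i j → split i j)) ⟩
    gauss (suc m) 0 * t 0 + ∑ m (λ i j → gauss⁻ i (suc j) * t (suc j) + gauss i j * (q ^ i * t (suc j)))
      ≈⟨ +-cong (*-congʳ (gauss-zeroʳ m)) (sym (∑-+ m _ _)) ⟨
    gauss m 0 * t 0 + (∑ m (λ i j → gauss⁻ i (suc j) * t (suc j)) + ∑ m (λ i j → gauss i j * (q ^ i * t (suc j))))
      ≈⟨ +-assoc _ _ _ ⟨
    gauss m 0 * t 0 + ∑ m (λ i j → gauss⁻ i (suc j) * t (suc j)) + ∑ m (λ i j → gauss i j * (q ^ i * t (suc j)))
      ≈⟨ +-congʳ (∑-last m (λ i j → gauss⁻ i j * t j)) ⟨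
    0# * t (suc m) + ∑ m (λ i j → gauss i j * t j) + ∑ m (λ i j → gauss i j * (q ^ i * t (suc j)))
      ≈⟨ +-cong (trans (+-congʳ (zeroˡ _)) (+-identityˡ _))
          (∑-cong′ m (λ i j i+j≡m → *-congˡ (sym (term-suc uv≈q i j a b i+j≡m)))) ⟩
    ∑ m (λ i j → gauss i j * t j) + ∑ m (λ i j → gauss i j * (u * q ^ a * t j))
      ≈⟨ +-cong (sym (*-identityʳ _))
          (trans (∑-cong m (λ i j → trans (*-congˡ (*-comm _ _)) (sym (*-assoc _ _ _))))
                 (sym (∑-* m _ _))) ⟩
    gaussSum u v a b * 1# + gaussSum u v a b * (u * q ^ a)
      ≈⟨ distribˡ _ _ _ ⟨
    gaussSum u v a b * (1# + u * q ^ a) ∎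
    where
    m = a ℕ.+ b
    t = λ j → term u v j b
    -- The binomial with first argument lowered by one, and 0 when there is none; this extends
    -- Pascal's rule to the boundary `i = 0`.
    gauss⁻ : ℕ → ℕ → Carrier
    gauss⁻ zero    j = 0#
    gauss⁻ (suc i) j = gauss i j
    split : ∀ i j → gauss i (suc j) * t (suc j)
                  ≈ gauss⁻ i (suc j) * t (suc j) + gauss i j * (q ^ i * t (suc j))
    split zero    j = solve 1 (λ x → con (+ 1) :* x
                       := con (+ 0) :* x :+ con (+ 1) :* (con (+ 1) :* x)) refl (t (suc j))
    split (suc i) j = solve 4 (λ x g h y → (g :+ x :* h) :* y := g :* y :+ h :* (x :* y)) refl _ _ _ _

  -- Turns growth in `b` into growth in `a`, so that one recursion step serves both directions.
  gaussSum-swap : ∀ u v b → gaussSum u v 0 b ≈ gaussSum v u b 0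
  gaussSum-swap u v b rewrite ℕ.+-identityʳ b = begin
    ∑ b (λ i j → gauss i j * term u v j b)
      ≈⟨ ∑-flip b _ ⟩
    ∑ b (λ i j → gauss j i * term u v i b)
      ≈⟨ ∑-cong′ b (λ i j eq → *-cong (gauss-comm j i) (reflexive (term-swap u v i j 0 b eq))) ⟩
    ∑ b (λ i j → gauss i j * term v u j 0) ∎

  gaussSum-product : ∀ {u v} → u * v ≈ q → ∀ a b → gaussSum u v a b ≈ poch u a * poch v b
  gaussSum-product uv≈q zero zero = refl
  gaussSum-product {u} {v} uv≈q zero (suc b) = begin
    gaussSum u v 0 (suc b)                 ≈⟨ gaussSum-swap u v (suc b) ⟩
    gaussSum v u (suc b) 0                 ≈⟨ gaussSum-suc (trans (*-comm v u) uv≈q) b 0 ⟩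
    gaussSum v u b 0 * (1# + v * q ^ b)    ≈⟨ *-congʳ (gaussSum-swap u v b) ⟨
    gaussSum u v 0 b * (1# + v * q ^ b)    ≈⟨ *-congʳ (gaussSum-product uv≈q zero b) ⟩
    1# * poch v b * (1# + v * q ^ b)       ≈⟨ *-assoc _ _ _ ⟩
    1# * poch v (suc b)                    ∎
  gaussSum-product {u} {v} uv≈q (suc a) b = begin
    gaussSum u v (suc a) b                          ≈⟨ gaussSum-suc uv≈q a b ⟩
    gaussSum u v a b * (1# + u * q ^ a)             ≈⟨ *-congʳ (gaussSum-product uv≈q a b) ⟩
    poch u a * poch v b * (1# + u * q ^ a)
      ≈⟨ solve 3 (λ x y z → x :* y :* z := x :* z :* y) refl _ _ _ ⟩
    poch u (suc a) * poch v b                       ∎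

  ∑-term : ∀ u v a b → ∑ (a ℕ.+ b) (λ i j → term u v j b)
                     ≈ ∑< (suc a) (tri u) + ∑< b (λ l → tri v (suc l))
  ∑-term u v a zero rewrite ℕ.+-identityʳ a = begin
    ∑ a (λ i j → term u v j 0)   ≈⟨ ∑-cong a (λ i → term-zeroʳ) ⟩
    ∑ a (λ i j → tri u j)        ≈⟨ ∑-snd a (tri u) ⟩
    ∑< (suc a) (tri u)           ≈⟨ +-identityʳ _ ⟨
    ∑< (suc a) (tri u) + 0#      ∎
    where
    term-zeroʳ : ∀ j → term u v j 0 ≈ tri u j
    term-zeroʳ zero    = refl
    term-zeroʳ (suc j) = refl
  ∑-term u v a (suc b) rewrite ℕ.+-suc a b = begin
    ∑ (suc (a ℕ.+ b)) (λ i j → term u v j (suc b))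
      ≈⟨ ∑-last (a ℕ.+ b) (λ i j → term u v j (suc b)) ⟩
    tri v (suc b) + ∑ (a ℕ.+ b) (λ i j → term u v j b)
      ≈⟨ +-congˡ (∑-term u v a b) ⟩
    tri v (suc b) + (∑< (suc a) (tri u) + ∑< b (λ l → tri v (suc l)))
      ≈⟨ solve 3 (λ x y z → x :+ (y :+ z) := y :+ (z :+ x)) refl _ _ _ ⟩
    ∑< (suc a) (tri u) + ∑< (suc b) (λ l → tri v (suc l)) ∎

  module _ {M : ℕ} (qᴹ≈0 : q ^ M ≈ 0#) where

    q^≈0 : ∀ {n} → M ℕ.≤ n → q ^ n ≈ 0#
    q^≈0 {n} M≤n = begin
      q ^ n                      ≡⟨ ≡.cong (q ^_) (ℕ.m+[n∸m]≡n M≤n) ⟨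
      q ^ (M ℕ.+ (n ℕ.∸ M))      ≈⟨ ^-homo-* q M _ ⟩
      q ^ M * q ^ (n ℕ.∸ M)      ≈⟨ *-congʳ qᴹ≈0 ⟩
      0# * q ^ (n ℕ.∸ M)         ≈⟨ zeroˡ _ ⟩
      0#                         ∎

    poch-stable : ∀ u {n} → M ℕ.≤ n → poch u n ≈ poch u M
    poch-stable u {n} M≤n =
      trans (reflexive (≡.cong (poch u) (≡.sym (ℕ.m+[n∸m]≡n M≤n)))) (stable (n ℕ.∸ M))
      where
      stable : ∀ d → poch u (M ℕ.+ d) ≈ poch u M
      stable zero    = reflexive (≡.cong (poch u) (ℕ.+-identityʳ M))
      stable (suc d) rewrite ℕ.+-suc M d = begin
        poch u (M ℕ.+ d) * (1# + u * q ^ (M ℕ.+ d))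
          ≈⟨ *-cong (stable d) (+-congˡ (*-congˡ (q^≈0 (ℕ.m≤m+n M d)))) ⟩
        poch u M * (1# + u * 0#)
          ≈⟨ solve 2 (λ p u → p :* (con (+ 1) :+ u :* con (+ 0)) := p) refl _ _ ⟩
        poch u M ∎

    -- Every factor `1 - q ^ suc n` is one minus a nilpotent element, and the geometric sum of
    -- length `M` inverts it.
    euler-inverse : ∀ n → ∃ λ e → e * euler n ≈ 1#
    euler-inverse zero    = 1# , *-identityˡ 1#
    euler-inverse (suc n) with euler-inverse n
    ... | e , e*euler≈1 = geometric x M * e , (begin
      geometric x M * e * (euler n * (1# + - q * q ^ n))
        ≈⟨ solve 5 (λ g e p x y → g :* e :* (p :* (con (+ 1) :+ :- x :* y))
                               := (e :* p) :* (g :* (con (+ 1) :- x :* y))) refl _ _ _ _ _ ⟩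
      e * euler n * (geometric x M * (1# - x))
        ≈⟨ *-cong e*euler≈1 (geometric-* x M) ⟩
      1# * (1# - x ^ M)
        ≈⟨ *-congˡ (+-congˡ (-‿cong (trans (^-assocʳ q (suc n) M) (q^≈0 (ℕ.m≤n*m M (suc n)))))) ⟩
      1# * (1# - 0#)
        ≈⟨ solve 0 (con (+ 1) :* (con (+ 1) :- con (+ 0)) := con (+ 1)) refl ⟩
      1# ∎)
      where x = q ^ suc n

    tri≈0 : ∀ u {k} → M ℕ.< k → tri u k ≈ 0#
    tri≈0 u {suc k} (s≤s M≤k) =
      trans (*-congˡ (trans (*-congˡ (q^≈0 M≤k)) (zeroʳ u))) (zeroʳ _)

    term≈0-right : ∀ u v m n → n ℕ.+ M ℕ.< m → term u v m n ≈ 0#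
    term≈0-right u v (suc m) zero    M<m       = tri≈0 u M<m
    term≈0-right u v (suc m) (suc n) (s≤s n+M<m) = term≈0-right u v m n n+M<m

    term≈0-left : ∀ u v m n → m ℕ.+ M ℕ.< n → term u v m n ≈ 0#
    term≈0-left u v zero    n       M<n         = tri≈0 v M<n
    term≈0-left u v (suc m) (suc n) (s≤s m+M<n) = term≈0-left u v m n m+M<n

    -- For large `i` and `j` the three `euler` products in the quotient formula all equal `euler M`,
    -- so the binomial becomes the inverse of `euler M`.
    gauss-*-euler≈1 : ∀ {i j} → M ℕ.≤ i → M ℕ.≤ j → gauss i j * euler M ≈ 1#
    gauss-*-euler≈1 {i} {j} M≤i M≤j = begin
      gauss i j * euler M
        ≈⟨ trans (sym (*-identityˡ _)) (*-congʳ (sym e*euler≈1)) ⟩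
      e * euler M * (gauss i j * euler M)
        ≈⟨ solve 3 (λ e p g → e :* p :* (g :* p) := e :* (g :* (p :* p))) refl _ _ _ ⟩
      e * (gauss i j * (euler M * euler M))
        ≈⟨ *-congˡ (*-congˡ (*-cong (poch-stable (- q) M≤i) (poch-stable (- q) M≤j))) ⟨
      e * (gauss i j * (euler i * euler j))
        ≈⟨ *-congˡ (gauss-*-euler i j) ⟩
      e * euler (i ℕ.+ j)
        ≈⟨ *-congˡ (poch-stable (- q) (ℕ.≤-trans M≤i (ℕ.m≤m+n i j))) ⟩
      e * euler M
        ≈⟨ e*euler≈1 ⟩
      1# ∎
      where
      e = proj₁ (euler-inverse M)
      e*euler≈1 = proj₂ (euler-inverse M)

    -- The finite form at `a = b = n`, times `euler M`. If `j` differs from `n` by more than `M`,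
    -- the term is zero. Otherwise `n ≥ 2M` forces both `i ≥ M` and `j ≥ M`, and the binomial
    -- cancels `euler M`.
    jacobiTripleProduct :
      ∀ {u v} → u * v ≈ q → ∀ {n} → M ℕ.+ M ℕ.≤ n →
      ∑< (suc n) (tri u) + ∑< n (λ l → tri v (suc l)) ≈ poch u n * poch v n * euler M
    jacobiTripleProduct {u} {v} uv≈q {n} M+M≤n = begin
      ∑< (suc n) (tri u) + ∑< n (λ l → tri v (suc l))
        ≈⟨ ∑-term u v n n ⟨
      ∑ (n ℕ.+ n) (λ i j → term u v j n)
        ≈⟨ ∑-cong′ (n ℕ.+ n) drop-gauss ⟨
      ∑ (n ℕ.+ n) (λ i j → gauss i j * term u v j n * euler M)
        ≈⟨ ∑-* (n ℕ.+ n) (euler M) _ ⟨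
      gaussSum u v n n * euler M
        ≈⟨ *-congʳ (gaussSum-product uv≈q n n) ⟩
      poch u n * poch v n * euler M ∎
      where
      drop-gauss : ∀ i j → i ℕ.+ j ≡ n ℕ.+ n →
                   gauss i j * term u v j n * euler M ≈ term u v j n
      drop-gauss i j i+j≡n+n with j ℕ.≤? n ℕ.+ M | n ℕ.≤? j ℕ.+ M
      ... | no j≰n+M | _ = trans (trans (*-congʳ (trans (*-congˡ t≈0) (zeroʳ _))) (zeroˡ _)) (sym t≈0)
        where t≈0 = term≈0-right u v j n (ℕ.≰⇒> j≰n+M)
      ... | _ | no n≰j+M = trans (trans (*-congʳ (trans (*-congˡ t≈0) (zeroʳ _))) (zeroˡ _)) (sym t≈0)
        where t≈0 = term≈0-left u v j n (ℕ.≰⇒> n≰j+M)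
      ... | yes j≤n+M | yes n≤j+M = begin
        gauss i j * term u v j n * euler M
          ≈⟨ solve 3 (λ g t p → g :* t :* p := g :* p :* t) refl _ _ _ ⟩
        gauss i j * euler M * term u v j n
          ≈⟨ *-congʳ (gauss-*-euler≈1 M≤i M≤j) ⟩
        1# * term u v j n
          ≈⟨ *-identityˡ _ ⟩
        term u v j n ∎
        where
        M≤j : M ℕ.≤ j
        M≤j = ℕ.+-cancelʳ-≤ M M j (ℕ.≤-trans M+M≤n n≤j+M)
        M≤i : M ℕ.≤ i
        M≤i = ℕ.+-cancelʳ-≤ (n ℕ.+ M) M i (ℕ.≤-trans
          (ℕ.≤-reflexive (≡.trans (≡.cong (M ℕ.+_) (ℕ.+-comm n M)) (≡.sym (ℕ.+-assoc M M n))))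
          (ℕ.≤-trans (ℕ.+-monoˡ-≤ n M+M≤n)
          (ℕ.≤-trans (ℕ.≤-reflexive (≡.sym i+j≡n+n)) (ℕ.+-monoʳ-≤ i j≤n+M))))

-- The involution that proves P · P³ = F · ∑ q^(s(2s+1)) on the level of theta series.

module LatticeInvolution {c ℓ} (R : CommutativeRing c ℓ) (q : CommutativeRing.Carrier R) where

  open import Data.Integer.Tactic.RingSolver using (solve-∀)

  open CommutativeRing R hiding (zero)
  open import Algebra.Properties.Ring ring using (-1*x≈-x; -‿distribˡ-*)
  open import Algebra.Properties.Semiring.Exp semiring
  open import Relation.Binary.Reasoning.Setoid setoid
  open IntegerMultiples R using (⟦_⟧; ⟦+⟧; ⟦-⟧; ⟦*⟧; solve; _:+_; _:*_; _:-_; :-_; _:=_)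
  open IntervalSums R
  open JacobiTripleProduct R q using (q^≈0)
  open ThetaExponents

  -- The coefficient function is a parameter because P and F differ only in it, and their products
  -- are later examined by one argument.
  pentagonalTermWith : (ℤ → ℤ) → ℤ → Carrier
  pentagonalTermWith a k = ⟦ a k ⟧ * q ^ pentagonal k

  pentagonalTerm weightedPentagonalTerm hexagonalTerm weightedHexagonalTerm : ℤ → Carrier
  pentagonalTerm          = pentagonalTermWith (λ k → alternating ∣ k ∣)
  weightedPentagonalTerm  = pentagonalTermWith (λ k → + 6 ℤ.* k ℤ.+ + 1)
  hexagonalTerm s         = q ^ hexagonal s
  weightedHexagonalTerm s = ⟦ + 4 ℤ.* s ℤ.+ + 1 ⟧ * q ^ hexagonal s

  monomial-* : ∀ a b m n → ⟦ a ⟧ * q ^ m * (⟦ b ⟧ * q ^ n) ≈ ⟦ a ℤ.* b ⟧ * q ^ (m ℕ.+ n)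
  monomial-* a b m n = begin
    ⟦ a ⟧ * q ^ m * (⟦ b ⟧ * q ^ n)
      ≈⟨ solve 4 (λ a b x y → a :* x :* (b :* y) := a :* b :* (x :* y)) refl _ _ _ _ ⟩
    ⟦ a ⟧ * ⟦ b ⟧ * (q ^ m * q ^ n)
      ≈⟨ *-cong (⟦*⟧ a b) (^-homo-* q m n) ⟨
    ⟦ a ℤ.* b ⟧ * q ^ (m ℕ.+ n) ∎

  weight : ℤ → ℤ → ℤ
  weight k s = alternating ∣ k ∣ ℤ.* (+ 4 ℤ.* s ℤ.+ + 1) ℤ.- (+ 6 ℤ.* k ℤ.+ + 1)

  -- The term at `(k , s)` of the left double series minus that of the right one.
  difference : ℤ → ℤ → Carrier
  difference k s = ⟦ weight k s ⟧ * q ^ (pentagonal k ℕ.+ hexagonal s)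

  latticeTerm : ℤ → ℤ → Carrier
  latticeTerm k t = ⟦ + 4 ℤ.* t ⟧ * q ^ latticeExponent k t

  difference-even : ∀ l t → alternating ∣ l ℤ.+ l ∣ ≡ + 1 →
                    difference (l ℤ.+ l) (t ℤ.+ + 3 ℤ.* l) ≡ latticeTerm (l ℤ.+ l) t
  difference-even l t alt = ≡.cong₂ (λ w e → ⟦ w ⟧ * q ^ e)
    (≡.trans (≡.cong (λ a → a ℤ.* (+ 4 ℤ.* (t ℤ.+ + 3 ℤ.* l) ℤ.+ + 1)
                                 ℤ.- (+ 6 ℤ.* (l ℤ.+ l) ℤ.+ + 1)) alt) (step l t)) (latticeExponent-even l t)
    where
    step : ∀ l t → + 1 ℤ.* (+ 4 ℤ.* (t ℤ.+ + 3 ℤ.* l) ℤ.+ + 1) ℤ.- (+ 6 ℤ.* (l ℤ.+ l) ℤ.+ + 1) ≡ + 4 ℤ.* t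
    step = solve-∀

  difference-odd : ∀ l t → alternating ∣ + 1 ℤ.+ (l ℤ.+ l) ∣ ≡ ℤ.- + 1 →
                   difference (+ 1 ℤ.+ (l ℤ.+ l)) (ℤ.- (t ℤ.+ (+ 2 ℤ.+ + 3 ℤ.* l)))
                   ≡ latticeTerm (+ 1 ℤ.+ (l ℤ.+ l)) t
  difference-odd l t alt = ≡.cong₂ (λ w e → ⟦ w ⟧ * q ^ e)
    (≡.trans (≡.cong (λ a → a ℤ.* (+ 4 ℤ.* ℤ.- (t ℤ.+ (+ 2 ℤ.+ + 3 ℤ.* l)) ℤ.+ + 1)
                                 ℤ.- (+ 6 ℤ.* (+ 1 ℤ.+ (l ℤ.+ l)) ℤ.+ + 1)) alt) (step l t)) (latticeExponent-odd l t)
    where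
    step : ∀ l t → ℤ.- + 1 ℤ.* (+ 4 ℤ.* ℤ.- (t ℤ.+ (+ 2 ℤ.+ + 3 ℤ.* l)) ℤ.+ + 1)
                   ℤ.- (+ 6 ℤ.* (+ 1 ℤ.+ (l ℤ.+ l)) ℤ.+ + 1) ≡ + 4 ℤ.* t
    step = solve-∀

  latticeTerm-involution : ∀ k t → latticeTerm (k ℤ.+ t) (ℤ.- t) ≈ - latticeTerm k t
  latticeTerm-involution k t = begin
    ⟦ + 4 ℤ.* ℤ.- t ⟧ * q ^ latticeExponent (k ℤ.+ t) (ℤ.- t)
      ≡⟨ ≡.cong₂ (λ w e → ⟦ w ⟧ * q ^ e) (ℤ.neg-distribʳ-* (+ 4) t) (≡.sym (latticeExponent-involution k t)) ⟨
    ⟦ ℤ.- (+ 4 ℤ.* t) ⟧ * q ^ latticeExponent k t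
      ≈⟨ *-congʳ (⟦-⟧ (+ 4 ℤ.* t)) ⟩
    - ⟦ + 4 ℤ.* t ⟧ * q ^ latticeExponent k t
      ≈⟨ -‿distribˡ-* _ _ ⟨
    - latticeTerm k t ∎

  module _ {M : ℕ} (qᴹ≈0 : q ^ M ≈ 0#) where

    term≈0 : ∀ x {e} → M ℕ.≤ e → x * q ^ e ≈ 0#
    term≈0 x M≤e = trans (*-congˡ (q^≈0 qᴹ≈0 M≤e)) (zeroʳ x)

    difference≈0ˡ : ∀ k s → M ℕ.≤ ∣ k ∣ → difference k s ≈ 0#
    difference≈0ˡ k s M≤∣k∣ = term≈0 _ (ℕ.≤-trans M≤∣k∣
      (ℕ.≤-trans (∣k∣≤pentagonal k) (ℕ.m≤m+n (pentagonal k) (hexagonal s))))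

    difference≈0ʳ : ∀ k s → M ℕ.≤ ∣ s ∣ → difference k s ≈ 0#
    difference≈0ʳ k s M≤∣s∣ = term≈0 _ (ℕ.≤-trans M≤∣s∣
      (ℕ.≤-trans (∣k∣≤hexagonal s) (ℕ.m≤n+m (hexagonal s) (pentagonal k))))

    latticeTerm≈0 : ∀ k t → M ℕ.≤ ∣ k ∣ → latticeTerm k t ≈ 0#
    latticeTerm≈0 k t M≤∣k∣ = term≈0 _ (ℕ.≤-trans M≤∣k∣
      (ℕ.≤-trans (∣k∣≤pentagonal k) (pentagonal≤latticeExponent k t)))

    -- For large `k` both rows vanish. Otherwise the half `l` of `k` has modulus below `M`, so the
    -- substitution for `s` is a shift by at most `2 + 3M`, preceded by a reflection when `k` is
    -- odd.
    difference-reindex : ∀ {n} → M ℕ.+ (2 ℕ.+ 3 ℕ.* M) ℕ.≤ n → ∀ k →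
                         ∑ℤ n (difference k) ≈ ∑ℤ n (latticeTerm k)
    difference-reindex {n} large k with M ℕ.≤? ∣ k ∣
    ... | yes M≤∣k∣ = trans (∑ℤ-zero n (λ s → difference≈0ˡ k s M≤∣k∣))
                            (sym (∑ℤ-zero n (λ t → latticeTerm≈0 k t M≤∣k∣)))
    ... | no M≰∣k∣ with parity k
    ...   | even l ≡.refl ∣l∣≤∣k∣ alt = sym (begin
      ∑ℤ n (latticeTerm k)
        ≈⟨ ∑ℤ-cong n (λ t → reflexive (difference-even l t alt)) ⟨
      ∑ℤ n (λ t → difference k (t ℤ.+ + 3 ℤ.* l))
        ≈⟨ ∑ℤ-shift (difference k) (difference≈0ʳ k) (+ 3 ℤ.* l) bound ⟩
      ∑ℤ n (difference k) ∎)
      where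
      bound : M ℕ.+ ∣ + 3 ℤ.* l ∣ ℕ.≤ n
      bound rewrite ℤ.abs-* (+ 3) l = ℕ.≤-trans (ℕ.+-monoʳ-≤ M (ℕ.≤-trans
        (ℕ.*-monoʳ-≤ 3 (ℕ.≤-trans ∣l∣≤∣k∣ (ℕ.<⇒≤ (ℕ.≰⇒> M≰∣k∣)))) (ℕ.m≤n+m _ 2))) large
    ...   | odd l ≡.refl ∣l∣≤∣k∣ alt = sym (begin
      ∑ℤ n (latticeTerm k)
        ≈⟨ ∑ℤ-cong n (λ t → reflexive (difference-odd l t alt)) ⟨
      ∑ℤ n (λ t → difference k (ℤ.- (t ℤ.+ d)))
        ≈⟨ ∑ℤ-shift (λ s → difference k (ℤ.- s)) (λ s M≤∣s∣ → difference≈0ʳ k (ℤ.- s)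
             (ℕ.≤-trans M≤∣s∣ (ℕ.≤-reflexive (≡.sym (ℤ.∣-i∣≡∣i∣ s))))) d bound ⟩
      ∑ℤ n (λ s → difference k (ℤ.- s))
        ≈⟨ ∑ℤ-neg n (difference k) ⟩
      ∑ℤ n (difference k) ∎)
      where
      d = + 2 ℤ.+ + 3 ℤ.* l
      bound : M ℕ.+ ∣ d ∣ ℕ.≤ n
      bound = ℕ.≤-trans (ℕ.+-monoʳ-≤ M (ℕ.≤-trans (ℤ.∣i+j∣≤∣i∣+∣j∣ (+ 2) (+ 3 ℤ.* l))
        (ℕ.+-monoʳ-≤ 2 (ℕ.≤-trans (ℕ.≤-reflexive (ℤ.abs-* (+ 3) l))
          (ℕ.*-monoʳ-≤ 3 (ℕ.≤-trans ∣l∣≤∣k∣ (ℕ.<⇒≤ (ℕ.≰⇒> M≰∣k∣)))))))) large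

    -- Shifting `k` by `t` carries the row of `- t` to the negative of the row of `t`, so the row
    -- sums are odd in `t`; the row `t = 0` has coefficient `4t = 0`. The shift is at most `n`,
    -- hence the bound on `m`.
    latticeSum≈0 : ∀ {m n} → M ℕ.+ n ℕ.≤ m → ∑ℤ n (λ t → ∑ℤ m (λ k → latticeTerm k t)) ≈ 0#
    latticeSum≈0 {m} {n} M+n≤m = ∑ℤ-antisymmetric n (λ t → ∑ℤ m (λ k → latticeTerm k t))
      (∑ℤ-zero m (λ k → zeroˡ (q ^ latticeExponent k (+ 0))))
      (λ j j<n → antisymmetric (+ suc j) (ℕ.≤-trans (ℕ.+-monoʳ-≤ M j<n) M+n≤m))
      where
      antisymmetric : ∀ t → M ℕ.+ ∣ t ∣ ℕ.≤ m →
        ∑ℤ m (λ k → latticeTerm k (ℤ.- t)) ≈ - ∑ℤ m (λ k → latticeTerm k t)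
      antisymmetric t bound = begin
        ∑ℤ m (λ k → latticeTerm k (ℤ.- t))
          ≈⟨ ∑ℤ-shift (λ k → latticeTerm k (ℤ.- t)) (λ k → latticeTerm≈0 k (ℤ.- t)) t bound ⟨
        ∑ℤ m (λ k → latticeTerm (k ℤ.+ t) (ℤ.- t))
          ≈⟨ ∑ℤ-cong m (λ k → trans (latticeTerm-involution k t) (sym (-1*x≈-x _))) ⟩
        ∑ℤ m (λ k → - 1# * latticeTerm k t)
          ≈⟨ *-∑ℤ m (- 1#) (λ k → latticeTerm k t) ⟨
        - 1# * ∑ℤ m (λ k → latticeTerm k t)
          ≈⟨ -1*x≈-x _ ⟩
        - ∑ℤ m (λ k → latticeTerm k t) ∎

    -- The two windows differ in size: `n` must absorb the shifts of `s` by up to `2 + 3M`, and `m`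
    -- the shifts of `k` by any `t` of modulus at most `n`. The smallest choices give `cutoff`.
    pentagonal-hexagonal : ∀ {m n} → M ℕ.+ (2 ℕ.+ 3 ℕ.* M) ℕ.≤ n → M ℕ.+ n ℕ.≤ m →
      ∑ℤ m pentagonalTerm * ∑ℤ n weightedHexagonalTerm ≈ ∑ℤ m weightedPentagonalTerm * ∑ℤ n hexagonalTerm
    pentagonal-hexagonal {m} {n} large M+n≤m = begin
      ∑ℤ m pentagonalTerm * ∑ℤ n weightedHexagonalTerm
        ≈⟨ ∑ℤ-*-∑ℤ m n pentagonalTerm weightedHexagonalTerm ⟩
      ∑ℤ m (λ k → ∑ℤ n (λ s → pentagonalTerm k * weightedHexagonalTerm s))
        ≈⟨ ∑ℤ-cong m (λ k → trans (∑ℤ-cong n (split k)) (∑ℤ-+ n (difference k) (right k))) ⟩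
      ∑ℤ m (λ k → ∑ℤ n (difference k) + ∑ℤ n (right k))
        ≈⟨ ∑ℤ-+ m (λ k → ∑ℤ n (difference k)) (λ k → ∑ℤ n (right k)) ⟩
      ∑ℤ m (λ k → ∑ℤ n (difference k)) + ∑ℤ m (λ k → ∑ℤ n (right k))
        ≈⟨ +-cong difference≈0 (sym (∑ℤ-*-∑ℤ m n weightedPentagonalTerm hexagonalTerm)) ⟩
      0# + ∑ℤ m weightedPentagonalTerm * ∑ℤ n hexagonalTerm
        ≈⟨ +-identityˡ _ ⟩
      ∑ℤ m weightedPentagonalTerm * ∑ℤ n hexagonalTerm ∎
      where
      right : ℤ → ℤ → Carrier
      right k s = weightedPentagonalTerm k * hexagonalTerm s
      split : ∀ k s → pentagonalTerm k * weightedHexagonalTerm s ≈ difference k s + right k s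
      split k s = begin
        ⟦ a ⟧ * q ^ pentagonal k * (⟦ b ⟧ * q ^ hexagonal s)
          ≈⟨ solve 5 (λ a b c x y → a :* x :* (b :* y) := (a :* b :- c) :* (x :* y) :+ c :* x :* y)
               refl ⟦ a ⟧ ⟦ b ⟧ ⟦ w ⟧ (q ^ pentagonal k) (q ^ hexagonal s) ⟩
        (⟦ a ⟧ * ⟦ b ⟧ - ⟦ w ⟧) * (q ^ pentagonal k * q ^ hexagonal s) + right k s
          ≈⟨ +-congʳ (*-cong (+-cong (⟦*⟧ a b) (⟦-⟧ w)) (^-homo-* q (pentagonal k) (hexagonal s))) ⟨
        (⟦ a ℤ.* b ⟧ + ⟦ ℤ.- w ⟧) * q ^ (pentagonal k ℕ.+ hexagonal s) + right k s
          ≈⟨ +-congʳ (*-congʳ (⟦+⟧ (a ℤ.* b) (ℤ.- w))) ⟨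
        difference k s + right k s ∎
        where
        a = alternating ∣ k ∣
        b = + 4 ℤ.* s ℤ.+ + 1
        w = + 6 ℤ.* k ℤ.+ + 1
      difference≈0 : ∑ℤ m (λ k → ∑ℤ n (difference k)) ≈ 0#
      difference≈0 = begin
        ∑ℤ m (λ k → ∑ℤ n (difference k))         ≈⟨ ∑ℤ-cong m (difference-reindex large) ⟩
        ∑ℤ m (λ k → ∑ℤ n (latticeTerm k))        ≈⟨ ∑ℤ-swap m n latticeTerm ⟩
        ∑ℤ n (λ t → ∑ℤ m (λ k → latticeTerm k t)) ≈⟨ latticeSum≈0 M+n≤m ⟩
        0#                                       ∎

-- Euler's pentagonal number theorem and Gauss's triangular series.

module ThetaProducts {c ℓ} (R : CommutativeRing c ℓ) (q : CommutativeRing.Carrier R) where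

  open CommutativeRing R hiding (zero)
  open import Algebra.Properties.Semiring.Exp semiring
  open import Relation.Binary.Reasoning.Setoid setoid
  open IntegerMultiples R using (⟦_⟧; ⟦-⟧; solve; _:+_; _:*_; _:-_; :-_; con; _:=_)
  open IntervalSums R
  open ThetaExponents
  open LatticeInvolution R q
  open JacobiTripleProduct R q
  private module Q² = JacobiTripleProduct R (q ^ 2)
  private module Q³ = JacobiTripleProduct R (q ^ 3)

  signed-power : ∀ i m n → ⟦ i ⟧ * q ^ m * (- (q ^ n)) ≈ ⟦ ℤ.- i ⟧ * q ^ (m ℕ.+ n)
  signed-power i m n = begin
    ⟦ i ⟧ * q ^ m * (- (q ^ n))       ≈⟨ solve 3 (λ i x y → i :* x :* (:- y) := :- i :* (x :* y)) refl _ _ _ ⟩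
    - ⟦ i ⟧ * (q ^ m * q ^ n)         ≈⟨ *-cong (⟦-⟧ i) (^-homo-* q m n) ⟨
    ⟦ ℤ.- i ⟧ * q ^ (m ℕ.+ n)         ∎

  power-step : ∀ m n → - (q ^ m) * (q ^ 3) ^ n ≈ - (q ^ (m ℕ.+ 3 ℕ.* n))
  power-step m n = begin
    - (q ^ m) * (q ^ 3) ^ n         ≈⟨ *-congˡ (^-assocʳ q 3 n) ⟩
    - (q ^ m) * q ^ (3 ℕ.* n)       ≈⟨ solve 2 (λ x y → :- x :* y := :- (x :* y)) refl _ _ ⟩
    - (q ^ m * q ^ (3 ℕ.* n))       ≈⟨ -‿cong (^-homo-* q m (3 ℕ.* n)) ⟨
    - (q ^ (m ℕ.+ 3 ℕ.* n))         ∎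

  -- Base `q³` with `u = -q²` and `v = -q`: `2k + 3k(k - 1)/2 = k(3k + 1)/2`, and `v` gives the
  -- values at negative `k`.
  tri-pentagonal⁺ : ∀ k → Q³.tri (- (q ^ 2)) k ≈ pentagonalTerm (+ k)
  tri-pentagonal⁺ zero    = sym (*-identityˡ 1#)
  tri-pentagonal⁺ (suc k) = trans (*-cong (tri-pentagonal⁺ k) (power-step 2 k))
    (signed-power (alternating k) (pentagonal (+ k)) (2 ℕ.+ 3 ℕ.* k))

  tri-pentagonal⁻ : ∀ k → Q³.tri (- (q ^ 1)) (suc k) ≈ pentagonalTerm -[1+ k ]
  tri-pentagonal⁻ zero    = solve 1 (λ q → con (+ 1) :* ((:- (q :* con (+ 1))) :* con (+ 1))
                                        := con (ℤ.- + 1) :* (q :* con (+ 1))) refl q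
  tri-pentagonal⁻ (suc k) = trans (*-cong (tri-pentagonal⁻ k) (power-step 1 (suc k)))
    (trans (signed-power (alternating (suc k)) (pentagonal -[1+ k ]) (1 ℕ.+ 3 ℕ.* suc k))
           (*-congˡ (^-congʳ q (≡.cong (λ n → pentagonal -[1+ k ] ℕ.+ suc n) (ℕ.*-suc 3 k)))))

  -- The three products have the exponents `3i + 2`, `3i + 1` and `3i + 3`, which together are all
  -- positive integers.
  euler-trisection : ∀ n → Q³.poch (- (q ^ 2)) n * Q³.poch (- (q ^ 1)) n * Q³.euler n ≈ euler (n ℕ.* 3)
  euler-trisection zero    = trans (*-identityʳ _) (*-identityˡ 1#)
  euler-trisection (suc n) = begin
    Q³.poch (- (q ^ 2)) n * (1# + - (q ^ 2) * (q ^ 3) ^ n)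
      * (Q³.poch (- (q ^ 1)) n * (1# + - (q ^ 1) * (q ^ 3) ^ n))
      * (Q³.euler n * (1# + - (q ^ 3) * (q ^ 3) ^ n))
      ≈⟨ solve 5 (λ a b c q y → let 1′ = con (+ 1) in
           a :* (1′ :+ :- (q :* (q :* 1′)) :* y)
             :* (b :* (1′ :+ :- (q :* 1′) :* y))
             :* (c :* (1′ :+ :- (q :* (q :* (q :* 1′))) :* y))
           := a :* b :* c :* (1′ :+ :- q :* y) :* (1′ :+ :- q :* (q :* y))
             :* (1′ :+ :- q :* (q :* (q :* y)))) refl _ _ _ q ((q ^ 3) ^ n) ⟩
    Q³.poch (- (q ^ 2)) n * Q³.poch (- (q ^ 1)) n * Q³.euler n
      * (1# + - q * (q ^ 3) ^ n) * (1# + - q * (q * (q ^ 3) ^ n))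
      * (1# + - q * (q * (q * (q ^ 3) ^ n)))
      ≈⟨ *-cong (*-cong (*-cong (euler-trisection n) (factor y≈)) (factor (*-congˡ y≈)))
                (factor (*-congˡ (*-congˡ y≈))) ⟩
    euler (suc n ℕ.* 3) ∎
    where
    y≈ : (q ^ 3) ^ n ≈ q ^ (n ℕ.* 3)
    y≈ = trans (^-assocʳ q 3 n) (^-congʳ q (ℕ.*-comm 3 n))
    factor : ∀ {x y} → x ≈ y → 1# + - q * x ≈ 1# + - q * y
    factor x≈y = +-congˡ (*-congˡ x≈y)

  tri-triangular : ∀ k → tri q k ≈ q ^ triangular k
  tri-triangular zero    = refl
  tri-triangular (suc k) =
    trans (*-congʳ (tri-triangular k)) (sym (^-homo-* q (triangular k) (suc k)))

  -- For `u = q` and `v = 1` the two halves of the bilateral series coincide, each running over the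
  -- triangular numbers.
  tri-triangular⁻ : ∀ k → tri 1# (suc k) ≈ q ^ triangular k
  tri-triangular⁻ zero    = trans (*-identityˡ _) (*-identityˡ 1#)
  tri-triangular⁻ (suc k) =
    trans (*-cong (tri-triangular⁻ k) (*-identityˡ _)) (sym (^-homo-* q (triangular k) (suc k)))

  -- Factor by factor, `(1 + qʲ)(1 - qʲ) = 1 - q²ʲ`; so `poch q` is Q/P.
  euler-square : ∀ n → poch q n * euler n ≈ Q².euler n
  euler-square zero    = *-identityˡ 1#
  euler-square (suc n) = begin
    poch q n * (1# + q * q ^ n) * (euler n * (1# + - q * q ^ n))
      ≈⟨ solve 4 (λ a b q y → let 1′ = con (+ 1) in
           a :* (1′ :+ q :* y) :* (b :* (1′ :+ :- q :* y))
           := a :* b :* (1′ :+ :- (q :* (q :* 1′)) :* (y :* y))) refl _ _ q (q ^ n) ⟩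
    poch q n * euler n * (1# + - (q ^ 2) * (q ^ n * q ^ n))
      ≈⟨ *-cong (euler-square n) (+-congˡ (*-congˡ (sym y²≈))) ⟩
    Q².euler (suc n) ∎
    where
    y²≈ : (q ^ 2) ^ n ≈ q ^ n * q ^ n
    y²≈ = trans (^-assocʳ q 2 n) (trans (^-homo-* q n (n ℕ.+ 0)) (*-congˡ (^-congʳ q (ℕ.+-identityʳ n))))

  alternating-double : ∀ i → alternating (i ℕ.+ i) ≡ + 1
  alternating-double zero    = ≡.refl
  alternating-double (suc i) rewrite ℕ.+-suc i i | alternating-double i = ≡.refl

  module _ {M : ℕ} (qᴹ≈0 : q ^ M ≈ 0#) where

    power-nilpotent : ∀ k → (q ^ suc k) ^ M ≈ 0#
    power-nilpotent k = trans (^-assocʳ q (suc k) M) (q^≈0 qᴹ≈0 (ℕ.m≤n*m M (suc k)))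

    pentagonalNumberTheorem : ∀ {n} → M ℕ.+ M ℕ.≤ n → ∑ℤ n pentagonalTerm ≈ euler M
    pentagonalNumberTheorem {n} M+M≤n = begin
      ∑ℤ n pentagonalTerm
        ≈⟨ +-cong (∑<-cong (suc n) tri-pentagonal⁺) (∑<-cong n tri-pentagonal⁻) ⟨
      ∑< (suc n) (Q³.tri (- (q ^ 2))) + ∑< n (λ l → Q³.tri (- (q ^ 1)) (suc l))
        ≈⟨ Q³.jacobiTripleProduct {M = M} (power-nilpotent 2) uv≈q³ M+M≤n ⟩
      Q³.poch (- (q ^ 2)) n * Q³.poch (- (q ^ 1)) n * Q³.euler M
        ≈⟨ *-congˡ (Q³.poch-stable (power-nilpotent 2) _ M≤n) ⟨
      Q³.poch (- (q ^ 2)) n * Q³.poch (- (q ^ 1)) n * Q³.euler n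
        ≈⟨ euler-trisection n ⟩
      euler (n ℕ.* 3)
        ≈⟨ poch-stable qᴹ≈0 (- q) (ℕ.≤-trans M≤n (ℕ.m≤m*n n 3)) ⟩
      euler M ∎
      where
      M≤n = ℕ.≤-trans (ℕ.m≤m+n M M) M+M≤n
      uv≈q³ : - (q ^ 2) * - (q ^ 1) ≈ q ^ 3
      uv≈q³ = solve 1 (λ q → let 1′ = con (+ 1) in
        (:- (q :* (q :* 1′))) :* (:- (q :* 1′)) := q :* (q :* (q :* 1′))) refl q

    q^triangular≈0 : ∀ {n} → M ℕ.≤ n → q ^ triangular n ≈ 0#
    q^triangular≈0 M≤n = q^≈0 qᴹ≈0 (ℕ.≤-trans M≤n (n≤triangular _))

    module _ {L : ℕ} (M<L : M ℕ.< L) where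

      private
        M≤L = ℕ.<⇒≤ M<L
        -- Even, so that the triangular numbers of index below `n` are the `hexagonal` values on the
        -- window of size `L`, apart from the vanishing end `k = L`.
        n = L ℕ.+ L
        m = ℕ.pred n

        M≤m : M ℕ.≤ m
        M≤m = ℕ.<⇒≤pred (ℕ.≤-trans M<L (ℕ.m≤m+n L L))

        n≡1+m : n ≡ suc m
        n≡1+m = ≡.sym (ℕ.suc-pred n {{ℕ.>-nonZero (ℕ.≤-trans (s≤s z≤n) (ℕ.≤-trans M<L (ℕ.m≤m+n L L)))}})

        M≤n : M ℕ.≤ n
        M≤n = ℕ.≤-trans M≤L (ℕ.m≤m+n L L)

        M+M≤n : M ℕ.+ M ℕ.≤ n
        M+M≤n = ℕ.+-mono-≤ M≤L M≤L

      -- The bilateral sum is `2s`, and the first factor of `poch 1#` is also 2. Cancelling leaves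
      -- `s = (Q/P)² P`, which is then multiplied by P.
      gaussTriangular : ∀ {½} → ½ * (1# + 1#) ≈ 1# →
                        ∑ℤ L hexagonalTerm * euler M ≈ Q².euler M * Q².euler M
      gaussTriangular {½} ½*2≈1 = begin
        ∑ℤ L hexagonalTerm * euler M
          ≈⟨ *-congʳ (∑<-∑ℤ L (λ k → q ^ triangular k) hexagonalTerm (λ _ → refl) (λ _ → refl)
               (q^≈0 qᴹ≈0 (ℕ.≤-trans M≤L (∣k∣≤hexagonal (+ L))))) ⟨
        s * euler M
          ≈⟨ trans (sym (*-identityˡ _)) (*-congʳ (sym ½*2≈1)) ⟩
        ½ * (1# + 1#) * (s * euler M)
          ≈⟨ solve 3 (λ h s e → h :* con (+ 2) :* (s :* e) := h :* ((s :+ s) :* e)) refl _ _ _ ⟩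
        ½ * ((s + s) * euler M)
          ≈⟨ *-congˡ (*-congʳ twice) ⟩
        ½ * (poch q M * ((1# + 1#) * poch q M) * euler M * euler M)
          ≈⟨ solve 3 (λ h p e → h :* (p :* (con (+ 2) :* p) :* e :* e)
                             := h :* con (+ 2) :* (p :* e :* (p :* e))) refl _ _ _ ⟩
        ½ * (1# + 1#) * (poch q M * euler M * (poch q M * euler M))
          ≈⟨ trans (*-congʳ ½*2≈1) (*-identityˡ _) ⟩
        poch q M * euler M * (poch q M * euler M)
          ≈⟨ *-cong (euler-square M) (euler-square M) ⟩
        Q².euler M * Q².euler M ∎
        where
        s = ∑< n (λ k → q ^ triangular k)
        poch-1# : poch 1# n ≈ (1# + 1#) * poch q M
        poch-1# = begin
          poch 1# n                       ≡⟨ ≡.cong (poch 1#) n≡1+m ⟩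
          poch 1# (suc m)                 ≈⟨ poch-suc 1# m ⟩
          (1# + 1#) * poch (1# * q) m     ≈⟨ *-congˡ (poch-cong (*-identityˡ q) m) ⟩
          (1# + 1#) * poch q m            ≈⟨ *-congˡ (poch-stable qᴹ≈0 q M≤m) ⟩
          (1# + 1#) * poch q M            ∎
        twice : s + s ≈ poch q M * ((1# + 1#) * poch q M) * euler M
        twice = begin
          s + s
            ≈⟨ +-congʳ (trans (+-congˡ (q^triangular≈0 M≤n)) (+-identityʳ s)) ⟨
          ∑< (suc n) (λ k → q ^ triangular k) + s
            ≈⟨ +-cong (∑<-cong (suc n) tri-triangular) (∑<-cong n tri-triangular⁻) ⟨
          ∑< (suc n) (tri q) + ∑< n (λ l → tri 1# (suc l))
            ≈⟨ jacobiTripleProduct {M = M} qᴹ≈0 (*-identityʳ q) M+M≤n ⟩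
          poch q n * poch 1# n * euler M
            ≈⟨ *-congʳ (*-cong (poch-stable qᴹ≈0 q M≤n) poch-1#) ⟩
          poch q M * ((1# + 1#) * poch q M) * euler M ∎

-- Jacobi's series for P³, by differentiating the triple product over dual numbers.

module JacobiCube {c ℓ} (R : CommutativeRing c ℓ) (q : CommutativeRing.Carrier R) where

  open import Data.Integer.Tactic.RingSolver using (solve-∀)

  open CommutativeRing R hiding (zero)
  open import Algebra.Properties.Semiring.Exp semiring
  open import Relation.Binary.Reasoning.Setoid setoid
  open IntegerMultiples R using (⟦_⟧; ⟦+⟧; ⟦-⟧; solve; _:+_; _:*_; _:-_; :-_; con; _:=_)
  open IntervalSums R
  open ThetaExponents
  open LatticeInvolution R q
  open JacobiTripleProduct R q
  open ThetaProducts R q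

  -- Series up to the coefficient of `x` form R[x]/(x²); that coefficient plays the role of the
  -- derivative at `v = -1`.
  open TruncatedSeries R 1 using (Series; truncatedSeries; const)
  open SeriesSums R 1
  private module D where
    open CommutativeRing truncatedSeries public
    open import Algebra.Properties.Semiring.Exp (CommutativeRing.semiring truncatedSeries) public using (_^_)
    open IntervalSums truncatedSeries public using (∑<)
    open JacobiTripleProduct truncatedSeries (const q) public

  const-^-0 : ∀ k → (const q D.^ k) 0 ≈ q ^ k
  const-^-0 zero    = refl
  const-^-0 (suc k) = *-congˡ (const-^-0 k)

  const-^-1 : ∀ k → (const q D.^ k) 1 ≈ 0#
  const-^-1 zero    = refl
  const-^-1 (suc k) = trans (+-cong (trans (*-congˡ (const-^-1 k)) (zeroʳ q)) (zeroˡ _)) (+-identityʳ 0#)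

  poch-0 : ∀ f n → D.poch f n 0 ≈ poch (f 0) n
  poch-0 f zero    = refl
  poch-0 f (suc n) = *-cong (poch-0 f n) (+-congˡ (*-congˡ (const-^-0 n)))

  -- u = - q (1 + x) and v = - (1 - x), so that uv = q modulo x².
  u v : Series
  u _ = - q
  v zero    = - 1#
  v (suc _) = 1#

  u*v≈q : u D.* v D.≈ const q
  u*v≈q zero    _ = solve 1 (λ q → :- q :* :- con (+ 1) := q) refl q
  u*v≈q (suc zero) _ = solve 1 (λ q → :- q :* con (+ 1) :+ :- q :* :- con (+ 1) := con (+ 0)) refl q
  u*v≈q (suc (suc n)) (s≤s ())

  step-0 : ∀ f k x → f 0 ≈ x → (f D.* (const q D.^ k)) 0 ≈ x * q ^ k
  step-0 f k x f0≈x = *-cong f0≈x (const-^-0 k)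

  step-1 : ∀ f k x → f 1 ≈ x → (f D.* (const q D.^ k)) 1 ≈ x * q ^ k
  step-1 f k x f1≈x = trans
    (+-cong (trans (*-congˡ (const-^-1 k)) (zeroʳ _)) (*-cong f1≈x (const-^-0 k)))
    (+-identityˡ _)

  -- `tri u k` is `(-1)ᵏ (1 + x)ᵏ` times `q ^ triangular k`, so its coefficient at `x` gains a
  -- factor `k`.
  tri-u-0 : ∀ k → D.tri u k 0 ≈ ⟦ alternating k ⟧ * q ^ triangular k
  tri-u-1 : ∀ k → D.tri u k 1 ≈ ⟦ alternating k ℤ.* + k ⟧ * q ^ triangular k

  tri-u-0 zero    = sym (*-identityʳ _)
  tri-u-0 (suc k) = begin
    D.tri u k 0 * (u D.* (const q D.^ k)) 0
      ≈⟨ *-cong (tri-u-0 k) (step-0 u k (- q) refl) ⟩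
    ⟦ a ⟧ * q ^ triangular k * (- q * q ^ k)
      ≈⟨ solve 4 (λ a x q y → a :* x :* (:- q :* y) := :- a :* (x :* (q :* y))) refl ⟦ a ⟧ (q ^ triangular k) q (q ^ k) ⟩
    - ⟦ a ⟧ * (q ^ triangular k * q ^ suc k)
      ≈⟨ *-cong (⟦-⟧ a) (^-homo-* q (triangular k) (suc k)) ⟨
    ⟦ ℤ.- a ⟧ * q ^ triangular (suc k) ∎
    where a = alternating k

  tri-u-1 zero    = sym (zeroˡ _)
  tri-u-1 (suc k) = begin
    D.tri u k 0 * (u D.* (const q D.^ k)) 1 + D.tri u k 1 * (u D.* (const q D.^ k)) 0
      ≈⟨ +-cong (*-cong (tri-u-0 k) (step-1 u k (- q) refl)) (*-cong (tri-u-1 k) (step-0 u k (- q) refl)) ⟩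
    ⟦ a ⟧ * q ^ triangular k * (- q * q ^ k) + ⟦ a ℤ.* + k ⟧ * q ^ triangular k * (- q * q ^ k)
      ≈⟨ solve 5 (λ a b x q y → a :* x :* (:- q :* y) :+ b :* x :* (:- q :* y)
                             := :- (a :+ b) :* (x :* (q :* y))) refl ⟦ a ⟧ ⟦ a ℤ.* + k ⟧ (q ^ triangular k) q (q ^ k) ⟩
    - (⟦ a ⟧ + ⟦ a ℤ.* + k ⟧) * (q ^ triangular k * q ^ suc k)
      ≈⟨ *-cong (trans (⟦-⟧ (a ℤ.+ a ℤ.* + k)) (-‿cong (⟦+⟧ a (a ℤ.* + k))))
                (^-homo-* q (triangular k) (suc k)) ⟨
    ⟦ ℤ.- (a ℤ.+ a ℤ.* + k) ⟧ * q ^ triangular (suc k)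
      ≡⟨ ≡.cong (λ i → ⟦ i ⟧ * q ^ triangular (suc k)) (coefficient a (+ k)) ⟩
    ⟦ ℤ.- a ℤ.* + suc k ⟧ * q ^ triangular (suc k) ∎
    where
    a = alternating k
    coefficient : ∀ a k → ℤ.- (a ℤ.+ a ℤ.* k) ≡ ℤ.- a ℤ.* (+ 1 ℤ.+ k)
    coefficient = solve-∀

  -- `tri v (suc k)` is `(-1)ᵏ⁺¹ (1 - x)ᵏ⁺¹` times `q ^ triangular k`. At `x` the signs combine to
  -- `(-1)ᵏ (k + 1)`, which added to the `k` from `u` gives `2k + 1`.
  tri-v-0 : ∀ k → D.tri v (suc k) 0 ≈ ⟦ ℤ.- alternating k ⟧ * q ^ triangular k
  tri-v-1 : ∀ k → D.tri v (suc k) 1 ≈ ⟦ alternating k ℤ.* + suc k ⟧ * q ^ triangular k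

  tri-v-0 zero    = *-identityˡ _
  tri-v-0 (suc k) = begin
    D.tri v (suc k) 0 * (v D.* (const q D.^ suc k)) 0
      ≈⟨ *-cong (tri-v-0 k) (step-0 v (suc k) (- 1#) refl) ⟩
    ⟦ b ⟧ * q ^ triangular k * (- 1# * q ^ suc k)
      ≈⟨ solve 3 (λ b x y → b :* x :* (:- con (+ 1) :* y) := :- b :* (x :* y)) refl ⟦ b ⟧ _ _ ⟩
    - ⟦ b ⟧ * (q ^ triangular k * q ^ suc k)
      ≈⟨ *-cong (⟦-⟧ b) (^-homo-* q (triangular k) (suc k)) ⟨
    ⟦ ℤ.- b ⟧ * q ^ triangular (suc k) ∎
    where b = ℤ.- alternating k

  tri-v-1 zero    = solve 0 (con (+ 1) :* (:- con (+ 1) :* con (+ 0) :+ con (+ 1) :* con (+ 1))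
                             :+ con (+ 0) :* (:- con (+ 1) :* con (+ 1)) := con (+ 1) :* con (+ 1)) refl
  tri-v-1 (suc k) = begin
    D.tri v (suc k) 0 * (v D.* (const q D.^ suc k)) 1 + D.tri v (suc k) 1 * (v D.* (const q D.^ suc k)) 0
      ≈⟨ +-cong (*-cong (tri-v-0 k) (step-1 v (suc k) 1# refl)) (*-cong (tri-v-1 k) (step-0 v (suc k) (- 1#) refl)) ⟩
    ⟦ ℤ.- a ⟧ * q ^ triangular k * (1# * q ^ suc k) + ⟦ b ⟧ * q ^ triangular k * (- 1# * q ^ suc k)
      ≈⟨ solve 4 (λ a b x y → a :* x :* (con (+ 1) :* y) :+ b :* x :* (:- con (+ 1) :* y)
                           := (a :- b) :* (x :* y)) refl ⟦ ℤ.- a ⟧ ⟦ b ⟧ _ _ ⟩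
    (⟦ ℤ.- a ⟧ - ⟦ b ⟧) * (q ^ triangular k * q ^ suc k)
      ≈⟨ *-cong (trans (⟦+⟧ (ℤ.- a) (ℤ.- b)) (+-congˡ (⟦-⟧ b))) (^-homo-* q (triangular k) (suc k)) ⟨
    ⟦ ℤ.- a ℤ.- b ⟧ * q ^ triangular (suc k)
      ≡⟨ ≡.cong (λ i → ⟦ i ⟧ * q ^ triangular (suc k)) (coefficient a (+ k)) ⟩
    ⟦ ℤ.- a ℤ.* + suc (suc k) ⟧ * q ^ triangular (suc k) ∎
    where
    a = alternating k
    b = a ℤ.* + suc k
    coefficient : ∀ a k → ℤ.- a ℤ.- a ℤ.* (+ 1 ℤ.+ k) ≡ ℤ.- a ℤ.* (+ 2 ℤ.+ k)
    coefficient = solve-∀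

  module _ {M : ℕ} (qᴹ≈0 : q ^ M ≈ 0#) {L : ℕ} (M<L : M ℕ.< L) where

    private
      n = L ℕ.+ L

      L≤n : L ℕ.≤ n
      L≤n = ℕ.m≤m+n L L

      M≤n : M ℕ.≤ n
      M≤n = ℕ.≤-trans (ℕ.<⇒≤ M<L) L≤n

      constᴹ≈0 : const q D.^ M D.≈ D.0#
      constᴹ≈0 zero          _ = trans (const-^-0 M) qᴹ≈0
      constᴹ≈0 (suc zero)    _ = const-^-1 M
      constᴹ≈0 (suc (suc _)) (s≤s ())

      jacobiTerm : ℕ → Carrier
      jacobiTerm k = ⟦ alternating k ℤ.* (+ 2 ℤ.* + k ℤ.+ + 1) ⟧ * q ^ triangular k

      lhs-1 : (D.∑< (suc n) (D.tri u) D.+ D.∑< n (λ l → D.tri v (suc l))) 1 ≈ ∑< n jacobiTerm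
      lhs-1 = begin
        D.∑< (suc n) (D.tri u) 1 + D.∑< n (λ l → D.tri v (suc l)) 1
          ≡⟨ ≡.cong₂ _+_ (∑<-coefficient (suc n) (D.tri u) 1) (∑<-coefficient n (λ l → D.tri v (suc l)) 1) ⟩
        ∑< n (λ k → D.tri u k 1) + D.tri u n 1 + ∑< n (λ l → D.tri v (suc l) 1)
          ≈⟨ +-congʳ (trans (+-congˡ last≈0) (+-identityʳ _)) ⟩
        ∑< n (λ k → D.tri u k 1) + ∑< n (λ l → D.tri v (suc l) 1)
          ≈⟨ ∑<-+ n (λ k → D.tri u k 1) (λ l → D.tri v (suc l) 1) ⟨
        ∑< n (λ k → D.tri u k 1 + D.tri v (suc k) 1)
          ≈⟨ ∑<-cong n combine ⟩
        ∑< n jacobiTerm ∎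
        where
        -- The sum over `u` has one term more than the sum over `v`; its exponent is at least `M`.
        last≈0 : D.tri u n 1 ≈ 0#
        last≈0 = trans (tri-u-1 n) (trans (*-congˡ (q^triangular≈0 qᴹ≈0 M≤n)) (zeroʳ _))
        combine : ∀ k → D.tri u k 1 + D.tri v (suc k) 1 ≈ jacobiTerm k
        combine k = begin
          D.tri u k 1 + D.tri v (suc k) 1
            ≈⟨ +-cong (tri-u-1 k) (tri-v-1 k) ⟩
          ⟦ a ℤ.* + k ⟧ * q ^ triangular k + ⟦ a ℤ.* + suc k ⟧ * q ^ triangular k
            ≈⟨ distribʳ _ _ _ ⟨
          (⟦ a ℤ.* + k ⟧ + ⟦ a ℤ.* + suc k ⟧) * q ^ triangular k
            ≈⟨ *-congʳ (⟦+⟧ (a ℤ.* + k) (a ℤ.* + suc k)) ⟨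
          ⟦ a ℤ.* + k ℤ.+ a ℤ.* + suc k ⟧ * q ^ triangular k
            ≡⟨ ≡.cong (λ i → ⟦ i ⟧ * q ^ triangular k) (coefficient a (+ k)) ⟩
          jacobiTerm k ∎
          where
          a = alternating k
          coefficient : ∀ a k → a ℤ.* k ℤ.+ a ℤ.* (+ 1 ℤ.+ k) ≡ a ℤ.* (+ 2 ℤ.* k ℤ.+ + 1)
          coefficient = solve-∀

      -- `1 + v = x` is a factor of `V`, so `V 0 = 0` and the product rule leaves only
      -- `U 0 * V 1 * Z 0`, each factor being `euler M`.
      rhs-1 : (D.poch u n D.* D.poch v n D.* D.euler M) 1 ≈ euler M * euler M * euler M
      rhs-1 = begin
        U 0 * V 0 * Z 1 + (U 0 * V 1 + U 1 * V 0) * Z 0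
          ≈⟨ +-cong (*-congʳ (*-congˡ V0≈0)) (*-congʳ (+-cong (*-congˡ V1≈euler) (*-congˡ V0≈0))) ⟩
        U 0 * 0# * Z 1 + (U 0 * euler M + U 1 * 0#) * Z 0
          ≈⟨ solve 5 (λ u u′ e z z′ → u :* con (+ 0) :* z′ :+ (u :* e :+ u′ :* con (+ 0)) :* z := u :* e :* z)
               refl _ _ _ _ _ ⟩
        U 0 * euler M * Z 0
          ≈⟨ *-cong (*-congʳ (trans (poch-0 u n) (poch-stable qᴹ≈0 (- q) M≤n))) (poch-0 (D.- const q) M) ⟩
        euler M * euler M * euler M ∎
        where
        m = ℕ.pred n
        U = D.poch u n
        V = D.poch v n
        Z = D.euler M
        Y = D.poch (v D.* const q) m
        n≡1+m : n ≡ suc m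
        n≡1+m = ≡.sym (ℕ.suc-pred n {{ℕ.>-nonZero (ℕ.≤-trans (s≤s z≤n) (ℕ.≤-trans M<L L≤n))}})
        M≤m : M ℕ.≤ m
        M≤m = ℕ.<⇒≤pred (ℕ.≤-trans M<L L≤n)
        V≈ : V D.≈ (D.1# D.+ v) D.* Y
        V≈ = D.trans (D.reflexive (≡.cong (D.poch v) n≡1+m)) (D.poch-suc v m)
        V0≈0 : V 0 ≈ 0#
        V0≈0 = trans (V≈ 0 z≤n) (trans (*-congʳ (-‿inverseʳ 1#)) (zeroˡ _))
        V1≈euler : V 1 ≈ euler M
        V1≈euler = begin
          V 1                                     ≈⟨ V≈ 1 ℕ.≤-refl ⟩
          (1# - 1#) * Y 1 + (0# + 1#) * Y 0
            ≈⟨ solve 2 (λ y y′ → (con (+ 1) :- con (+ 1)) :* y′ :+ (con (+ 0) :+ con (+ 1)) :* y := y) refl _ _ ⟩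
          Y 0                                     ≈⟨ poch-0 (v D.* const q) m ⟩
          poch (- 1# * q) m
            ≈⟨ poch-cong (solve 1 (λ q → :- con (+ 1) :* q := :- q) refl q) m ⟩
          euler m                                 ≈⟨ poch-stable qᴹ≈0 (- q) M≤m ⟩
          euler M                                 ∎

    -- `(-1)ᵏ (2k + 1)` is `4s + 1` with `s = i` for `k = 2i` and `s = -1 - i` for `k = 2i + 1`.
    jacobiCube : ∑ℤ L weightedHexagonalTerm ≈ euler M * euler M * euler M
    jacobiCube = begin
      ∑ℤ L weightedHexagonalTerm
        ≈⟨ ∑<-∑ℤ L jacobiTerm weightedHexagonalTerm even-term odd-term
             (trans (*-congˡ (q^≈0 qᴹ≈0 (ℕ.≤-trans (ℕ.<⇒≤ M<L) (∣k∣≤hexagonal (+ L))))) (zeroʳ _)) ⟨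
      ∑< n jacobiTerm
        ≈⟨ lhs-1 ⟨
      (D.∑< (suc n) (D.tri u) D.+ D.∑< n (λ l → D.tri v (suc l))) 1
        ≈⟨ D.jacobiTripleProduct {M = M} constᴹ≈0 u*v≈q (ℕ.+-mono-≤ (ℕ.<⇒≤ M<L) (ℕ.<⇒≤ M<L)) 1 ℕ.≤-refl ⟩
      (D.poch u n D.* D.poch v n D.* D.euler M) 1
        ≈⟨ rhs-1 ⟩
      euler M * euler M * euler M ∎
      where
      even-term : ∀ i → jacobiTerm (i ℕ.+ i) ≈ weightedHexagonalTerm (+ i)
      even-term i rewrite alternating-double i =
        reflexive (≡.cong (λ j → ⟦ j ⟧ * q ^ triangular (i ℕ.+ i)) (coefficient (+ i)))
        where
        coefficient : ∀ i → + 1 ℤ.* (+ 2 ℤ.* (i ℤ.+ i) ℤ.+ + 1) ≡ + 4 ℤ.* i ℤ.+ + 1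
        coefficient = solve-∀
      odd-term : ∀ i → jacobiTerm (suc (i ℕ.+ i)) ≈ weightedHexagonalTerm -[1+ i ]
      odd-term i rewrite alternating-double i =
        reflexive (≡.cong (λ j → ⟦ j ⟧ * q ^ triangular (suc (i ℕ.+ i))) (coefficient (+ i)))
        where
        coefficient : ∀ i → ℤ.- + 1 ℤ.* (+ 2 ℤ.* (+ 1 ℤ.+ (i ℤ.+ i)) ℤ.+ + 1) ≡ + 4 ℤ.* ℤ.- (+ 1 ℤ.+ i) ℤ.+ + 1
        coefficient = solve-∀

-- The identity F Q² = P⁵ and its consequences for the seventh and eleventh powers of P.

module FifthPower {c ℓ} (R : CommutativeRing c ℓ) (q : CommutativeRing.Carrier R) where

  open CommutativeRing R hiding (zero)
  open import Algebra.Properties.Semiring.Exp semiring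
  open import Relation.Binary.Reasoning.Setoid setoid
  open IntegerMultiples R using (solve; _:*_; con; _:=_)
  open IntervalSums R
  open ThetaExponents using (cutoff)
  open LatticeInvolution R q
  open JacobiTripleProduct R q
  private module Q² = JacobiTripleProduct R (q ^ 2)
  open ThetaProducts R q
  open JacobiCube R q

  module _ {M : ℕ} (qᴹ≈0 : q ^ M ≈ 0#) where

    private
      L = M ℕ.+ (2 ℕ.+ 3 ℕ.* M)

      M<L : M ℕ.< L
      M<L = ℕ.≤-trans (ℕ.≤-reflexive (ℕ.+-comm 1 M)) (ℕ.+-monoʳ-≤ M (s≤s z≤n))

      E = ∑ℤ (cutoff M) pentagonalTerm
      F = ∑ℤ (cutoff M) weightedPentagonalTerm
      J = ∑ℤ L weightedHexagonalTerm
      T = ∑ℤ L hexagonalTerm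
      P = euler M
      Q = Q².euler M

    pentagonalSum : E ≈ P
    pentagonalSum = pentagonalNumberTheorem {M = M} qᴹ≈0 (ℕ.+-monoʳ-≤ M (ℕ.<⇒≤ M<L))

    fifthPower : ∀ {½} → ½ * (1# + 1#) ≈ 1# → F * (Q * Q) ≈ P * (P * (P * (P * P)))
    fifthPower ½*2≈1 = begin
      F * (Q * Q)                   ≈⟨ *-congˡ (gaussTriangular {M = M} qᴹ≈0 M<L ½*2≈1) ⟨
      F * (T * P)                   ≈⟨ *-assoc F T P ⟨
      F * T * P                     ≈⟨ *-congʳ (pentagonal-hexagonal {M = M} qᴹ≈0 ℕ.≤-refl ℕ.≤-refl) ⟨
      E * J * P                     ≈⟨ *-congʳ (*-cong pentagonalSum (jacobiCube {M = M} qᴹ≈0 M<L)) ⟩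
      P * (P * P * P) * P
        ≈⟨ solve 1 (λ p → p :* (p :* p :* p) :* p := p :* (p :* (p :* (p :* p)))) refl P ⟩
      P * (P * (P * (P * P)))       ∎

    module _ {½} (½*2≈1 : ½ * (1# + 1#) ≈ 1#) {A : Carrier} where

      -- Five of the factors P become F Q². Then Q² and one P cancel against `A`, and one P remains.
      seventhPower : A * (P * Q ^ 2) ≈ 1# → A * P ^ 7 ≈ E * F
      seventhPower A*PQ²≈1 = begin
        A * P ^ 7
          ≈⟨ solve 2 (λ a p → let p⁵ = p :* (p :* (p :* (p :* p))) in
               a :* (p :* (p :* (p :* (p :* (p :* (p :* (p :* con (+ 1))))))))
               := a :* p :* p :* p⁵) refl A P ⟩
        A * P * P * (P * (P * (P * (P * P))))
          ≈⟨ *-congˡ (fifthPower ½*2≈1) ⟨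
        A * P * P * (F * (Q * Q))
          ≈⟨ solve 4 (λ a p q f → a :* p :* p :* (f :* (q :* q))
               := a :* (p :* (q :* (q :* con (+ 1)))) :* (p :* f)) refl A P Q F ⟩
        A * (P * Q ^ 2) * (P * F)
          ≈⟨ trans (*-congʳ A*PQ²≈1) (*-identityˡ _) ⟩
        P * F
          ≈⟨ *-congʳ pentagonalSum ⟨
        E * F ∎

      -- Ten of the factors P become (F Q²)². Then Q⁴ and the remaining P cancel against `A`.
      eleventhPower : A * (P * Q ^ 4) ≈ 1# → A * P ^ 11 ≈ F * F
      eleventhPower A*PQ⁴≈1 = begin
        A * P ^ 11
          ≈⟨ solve 2 (λ a p → let p⁵ = p :* (p :* (p :* (p :* p))) in
               a :* (p :* (p :* (p :* (p :* (p :* (p :* (p :* (p :* (p :* (p :* (p :* con (+ 1))))))))))))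
               := a :* p :* p⁵ :* p⁵) refl A P ⟩
        A * P * (P * (P * (P * (P * P)))) * (P * (P * (P * (P * P))))
          ≈⟨ *-cong (*-congˡ (fifthPower ½*2≈1)) (fifthPower ½*2≈1) ⟨
        A * P * (F * (Q * Q)) * (F * (Q * Q))
          ≈⟨ solve 4 (λ a p q f → a :* p :* (f :* (q :* q)) :* (f :* (q :* q))
               := a :* (p :* (q :* (q :* (q :* (q :* con (+ 1)))))) :* (f :* f)) refl A P Q F ⟩
        A * (P * Q ^ 4) * (F * F)
          ≈⟨ trans (*-congʳ A*PQ⁴≈1) (*-identityˡ _) ⟩
        F * F ∎

-- Frobenius modulo 7 and 11.

module FreshmansDream {c ℓ} (R : CommutativeRing c ℓ) where

  open CommutativeRing R hiding (zero)
  open import Algebra.Properties.CommutativeSemiring.Exp commutativeSemiring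
  open import Relation.Binary.Reasoning.Setoid setoid
  open IntegerMultiples R using (⟦_⟧; solve; _:+_; _:*_; _:-_; :-_; _:^_; con; _:=_)

  private
    drop-multiple : ∀ {n} → n ≈ 0# → ∀ x y → x + n * y ≈ x
    drop-multiple n≈0 x y = trans (+-congˡ (trans (*-congʳ n≈0) (zeroˡ y))) (+-identityʳ x)

  -- The cofactor of 7 collects the middle binomial coefficients divided by 7, namely 1, 3, 5, 5, 3,
  -- 1 with alternating signs.
  [1-x]^7 : ⟦ + 7 ⟧ ≈ 0# → ∀ x → (1# - x) ^ 7 ≈ 1# - x ^ 7
  [1-x]^7 7≈0 x = trans
    (solve 1 (λ x → (con (+ 1) :- x) :^ 7 := con (+ 1) :- x :^ 7 :+ con (+ 7) :*
      (x :^ 6 :- con (+ 3) :* x :^ 5 :+ con (+ 5) :* x :^ 4 :- con (+ 5) :* x :^ 3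
        :+ con (+ 3) :* x :^ 2 :- x)) refl x)
    (drop-multiple 7≈0 _ _)

  [1-x]^11 : ⟦ + 11 ⟧ ≈ 0# → ∀ x → (1# - x) ^ 11 ≈ 1# - x ^ 11
  [1-x]^11 11≈0 x = trans
    (solve 1 (λ x → (con (+ 1) :- x) :^ 11 := con (+ 1) :- x :^ 11 :+ con (+ 11) :*
      (x :^ 10 :- con (+ 5) :* x :^ 9 :+ con (+ 15) :* x :^ 8 :- con (+ 30) :* x :^ 7
        :+ con (+ 42) :* x :^ 6 :- con (+ 42) :* x :^ 5 :+ con (+ 30) :* x :^ 4
        :- con (+ 15) :* x :^ 3 :+ con (+ 5) :* x :^ 2 :- x)) refl x)
    (drop-multiple 11≈0 _ _)

  1^n≈1 : ∀ n → 1# ^ n ≈ 1#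
  1^n≈1 zero    = refl
  1^n≈1 (suc n) = trans (*-identityˡ _) (1^n≈1 n)

  module _ (q : Carrier) (p : ℕ) (frobenius : ∀ x → (1# - x) ^ p ≈ 1# - x ^ p) where

    private
      module Q = JacobiTripleProduct R q
      module Qᵖ = JacobiTripleProduct R (q ^ p)

    euler-frobenius : ∀ n → Q.euler n ^ p ≈ Qᵖ.euler n
    euler-frobenius zero    = 1^n≈1 p
    euler-frobenius (suc n) = begin
      (Q.euler n * (1# + - q * q ^ n)) ^ p
        ≈⟨ ^-distrib-* (Q.euler n) _ p ⟩
      Q.euler n ^ p * (1# + - q * q ^ n) ^ p
        ≈⟨ *-cong (euler-frobenius n) (trans (^-congˡ p (Q.euler-factor n)) (frobenius (q ^ suc n))) ⟩
      Qᵖ.euler n * (1# - (q ^ suc n) ^ p)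
        ≈⟨ *-congˡ (+-congˡ (-‿cong (trans (^-assocʳ q (suc n) p)
             (trans (^-congʳ q (ℕ.*-comm (suc n) p)) (sym (^-assocʳ q p (suc n))))))) ⟩
      Qᵖ.euler n * (1# - (q ^ p) ^ suc n)
        ≈⟨ *-congˡ (Qᵖ.euler-factor n) ⟨
      Qᵖ.euler (suc n) ∎

-- Generating products built from the inverses of `1 - qʲ`.

module GeometricFactors {c ℓ} (R : CommutativeRing c ℓ) (q : CommutativeRing.Carrier R)
  (g : ℕ → CommutativeRing.Carrier R)
  (g-inverse : JacobiTripleProduct.GeometricInverses R q g) where

  open CommutativeRing R hiding (zero)

  open import Algebra.Properties.CommutativeSemiring.Exp commutativeSemiring
  open import Relation.Binary.Reasoning.Setoid setoid
  open IntegerMultiples R using (solve; _:*_; _:=_)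
  open FreshmansDream R using (1^n≈1; euler-frobenius)
  open JacobiTripleProduct R q
  private module Q² = JacobiTripleProduct R (q ^ 2)
  open ThetaProducts R q using (power-nilpotent)

  -- Here `c` counts the colours of even parts beyond the first, one less than in `a`.
  colouredProd : ℕ → ℕ → Carrier
  colouredProd c zero    = 1#
  colouredProd c (suc n) = colouredProd c n * (g n * g (n ℕ.+ suc n) ^ c)

  colouredProd-inverse : ∀ c n → colouredProd c n * (euler n * Q².euler n ^ c) ≈ 1#
  colouredProd-inverse c zero    = trans (*-identityˡ _) (trans (*-identityˡ _) (1^n≈1 c))
  colouredProd-inverse c (suc n) = begin
    A * (g n * h ^ c) * (euler n * (1# + - q * q ^ n) * (Q².euler n * (1# + - (q ^ 2) * (q ^ 2) ^ n)) ^ c)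
      ≈⟨ *-congˡ (*-cong (*-congˡ (euler-factor n))
                         (trans (^-distrib-* _ _ c) (*-congˡ (^-congˡ c factor²)))) ⟩
    A * (g n * h ^ c) * (euler n * (1# - q ^ suc n) * (Q².euler n ^ c * (1# - q ^ suc (n ℕ.+ suc n)) ^ c))
      ≈⟨ solve 7 (λ a g h e y f z → a :* (g :* h) :* (e :* y :* (f :* z))
                                := a :* (e :* f) :* (g :* y) :* (h :* z)) refl _ _ _ _ _ _ _ ⟩
    A * (euler n * Q².euler n ^ c) * (g n * (1# - q ^ suc n)) * (h ^ c * (1# - q ^ suc (n ℕ.+ suc n)) ^ c)
      ≈⟨ *-cong (*-cong (colouredProd-inverse c n) (g-inverse n))
                (trans (sym (^-distrib-* _ _ c)) (trans (^-congˡ c (g-inverse (n ℕ.+ suc n))) (1^n≈1 c))) ⟩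
    1# * 1# * 1#
      ≈⟨ trans (*-identityʳ _) (*-identityʳ _) ⟩
    1# ∎
    where
    A = colouredProd c n
    h = g (n ℕ.+ suc n)
    factor² : 1# + - (q ^ 2) * (q ^ 2) ^ n ≈ 1# - q ^ suc (n ℕ.+ suc n)
    factor² = trans (Q².euler-factor n) (+-congˡ (-‿cong (trans (^-assocʳ q 2 (suc n))
      (^-congʳ q (≡.cong (λ k → suc (n ℕ.+ k)) (ℕ.+-identityʳ (suc n)))))))

  -- The product has `n` factors, while the theta identities use the exponent `n + 1` at which
  -- powers of `q` vanish. The extra factors of both Euler products are 1.
  colouredProd-truncated-inverse : ∀ c {n} → q ^ suc n ≈ 0# →
                                   colouredProd c n * (euler (suc n) * Q².euler (suc n) ^ c) ≈ 1#
  colouredProd-truncated-inverse c {n} qⁿ⁺¹≈0 = trans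
    (*-congˡ (*-cong (euler-suc {n} qⁿ⁺¹≈0) (^-congˡ c (Q².euler-suc {n} (power-nilpotent {suc n} qⁿ⁺¹≈0 1)))))
    (colouredProd-inverse c n)

  module _ (p′ : ℕ) where

    private module Qᵖ = JacobiTripleProduct R (q ^ suc p′)

    -- ∏ 1/(1 - qᵖʲ) over 1 ≤ j ≤ n, where p = 1 + p′
    dilatedProd : ℕ → Carrier
    dilatedProd zero    = 1#
    dilatedProd (suc n) = dilatedProd n * g (n ℕ.+ p′ ℕ.* suc n)

    dilatedProd-inverse : ∀ n → dilatedProd n * Qᵖ.euler n ≈ 1#
    dilatedProd-inverse zero    = *-identityˡ 1#
    dilatedProd-inverse (suc n) = begin
      dilatedProd n * h * (Qᵖ.euler n * y)
        ≈⟨ solve 4 (λ d g e y → d :* g :* (e :* y) := d :* e :* (g :* y)) refl _ _ _ _ ⟩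
      dilatedProd n * Qᵖ.euler n * (h * y)
        ≈⟨ *-cong (dilatedProd-inverse n) (*-congˡ
             (trans (Qᵖ.euler-factor n) (+-congˡ (-‿cong (^-assocʳ q (suc p′) (suc n)))))) ⟩
      1# * (h * (1# - q ^ (suc p′ ℕ.* suc n)))
        ≈⟨ trans (*-identityˡ _) (g-inverse (n ℕ.+ p′ ℕ.* suc n)) ⟩
      1# ∎
      where
      h = g (n ℕ.+ p′ ℕ.* suc n)
      y = 1# + - (q ^ suc p′) * (q ^ suc p′) ^ n

    -- By Frobenius `euler n ^ p` is the Euler product in `qᵖ`, and `dilatedProd` is its inverse.
    via-dilatedProd : (∀ x → (1# - x) ^ suc p′ ≈ 1# - x ^ suc p′) → ∀ n {A G} →
                      A * euler n ^ suc p′ ≈ G → A ≈ G * dilatedProd n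
    via-dilatedProd frobenius n {A} {G} AP≈G = begin
      A                                             ≈⟨ *-identityʳ A ⟨
      A * 1#                                        ≈⟨ *-congˡ (dilatedProd-inverse n) ⟨
      A * (dilatedProd n * Qᵖ.euler n)              ≈⟨ *-congˡ (*-congˡ (euler-frobenius q (suc p′) frobenius n)) ⟨
      A * (dilatedProd n * euler n ^ suc p′)
        ≈⟨ solve 3 (λ a d e → a :* (d :* e) := a :* e :* d) refl _ _ _ ⟩
      A * euler n ^ suc p′ * dilatedProd n          ≈⟨ *-congʳ AP≈G ⟩
      G * dilatedProd n                             ∎

-- The generating functions as theta products times series in q⁷ and q¹¹.

module PartitionIdentities {c ℓ} (R : CommutativeRing c ℓ) (q : CommutativeRing.Carrier R)
  (g : ℕ → CommutativeRing.Carrier R)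
  (g-inverse : JacobiTripleProduct.GeometricInverses R q g) where

  open CommutativeRing R hiding (zero)
  open import Algebra.Properties.Semiring.Exp semiring

  open IntegerMultiples R using (⟦_⟧)
  open IntervalSums R using (∑ℤ)
  open LatticeInvolution R q using (pentagonalTerm; weightedPentagonalTerm)
  open GeometricFactors R q g g-inverse
  open FreshmansDream R
  open FifthPower R q
  open ThetaExponents using (cutoff)

  module Truncated (N : ℕ) (qᴺ⁺¹≈0 : q ^ suc N ≈ 0#) (½ : Carrier) (½*2≈1 : ½ * (1# + 1#) ≈ 1#) where

    colouredProd-2 : ⟦ + 7 ⟧ ≈ 0# → colouredProd 2 N ≈
      ∑ℤ (cutoff (suc N)) pentagonalTerm * ∑ℤ (cutoff (suc N)) weightedPentagonalTerm
        * dilatedProd 6 (suc N)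
    colouredProd-2 7≈0 = via-dilatedProd 6 ([1-x]^7 7≈0) (suc N)
      (seventhPower {M = suc N} qᴺ⁺¹≈0 ½*2≈1 (colouredProd-truncated-inverse 2 {N} qᴺ⁺¹≈0))

    colouredProd-4 : ⟦ + 11 ⟧ ≈ 0# → colouredProd 4 N ≈
      ∑ℤ (cutoff (suc N)) weightedPentagonalTerm * ∑ℤ (cutoff (suc N)) weightedPentagonalTerm
        * dilatedProd 10 (suc N)
    colouredProd-4 11≈0 = via-dilatedProd 10 ([1-x]^11 11≈0) (suc N)
      (eleventhPower {M = suc N} qᴺ⁺¹≈0 ½*2≈1 (colouredProd-truncated-inverse 4 {N} qᴺ⁺¹≈0))

-- The integers modulo `m`.

module IntegersModulo (m : ℤ) where

  open import Data.Integer.Base using (_+_; _*_; -_; _-_)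
  open import Data.Integer.Divisibility.Signed
    using (_∣_; divides; ∣m⇒∣-m; ∣m∣n⇒∣m+n; ∣m⇒∣m*n; ∣n⇒∣m*n)
  open import Data.Integer.Tactic.RingSolver using (solve-∀)
  open import Data.Product.Base using (_,_)
  open import Level using (0ℓ)
  open import Relation.Binary.PropositionalEquality

  infix 4 _~_
  -- A record, so that `i` and `j` can be inferred from a congruence although `i - j` does not
  -- determine them.
  record _~_ (i j : ℤ) : Set where
    constructor congruent
    field difference : m ∣ i - j

  open _~_

  ~-reflexive : ∀ {i j} → i ≡ j → i ~ j
  ~-reflexive {i} refl = congruent (divides (+ 0) (ℤ.+-inverseʳ i))

  ~-sym : ∀ {i j} → i ~ j → j ~ i
  ~-sym {i} {j} i~j = congruent (subst (m ∣_) (lemma i j) (∣m⇒∣-m (difference i~j)))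
    where
    lemma : ∀ i j → - (i - j) ≡ j - i
    lemma = solve-∀

  ~-trans : ∀ {i j k} → i ~ j → j ~ k → i ~ k
  ~-trans {i} {j} {k} i~j j~k = congruent (subst (m ∣_) (lemma i j k) (∣m∣n⇒∣m+n (difference i~j) (difference j~k)))
    where
    lemma : ∀ i j k → (i - j) + (j - k) ≡ i - k
    lemma = solve-∀

  +-cong : ∀ {i j k l} → i ~ j → k ~ l → i + k ~ j + l
  +-cong {i} {j} {k} {l} i~j k~l = congruent (subst (m ∣_) (lemma i j k l) (∣m∣n⇒∣m+n (difference i~j) (difference k~l)))
    where
    lemma : ∀ i j k l → (i - j) + (k - l) ≡ i + k - (j + l)
    lemma = solve-∀

  *-cong : ∀ {i j k l} → i ~ j → k ~ l → i * k ~ j * l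
  *-cong {i} {j} {k} {l} i~j k~l = congruent (
    subst (m ∣_) (lemma i j k l) (∣m∣n⇒∣m+n (∣m⇒∣m*n k (difference i~j)) (∣n⇒∣m*n j (difference k~l))))
    where
    lemma : ∀ i j k l → (i - j) * k + j * (k - l) ≡ i * k - j * l
    lemma = solve-∀

  -‿cong : ∀ {i j} → i ~ j → - i ~ - j
  -‿cong {i} {j} i~j = congruent (subst (m ∣_) (lemma i j) (∣m⇒∣-m (difference i~j)))
    where
    lemma : ∀ i j → - (i - j) ≡ - i - - j
    lemma = solve-∀

  ∣⇒~0 : ∀ {i} → m ∣ i → i ~ + 0
  ∣⇒~0 {i} m∣i = congruent (subst (m ∣_) (sym (ℤ.+-identityʳ i)) m∣i)

  ~0⇒∣ : ∀ {i} → i ~ + 0 → m ∣ i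
  ~0⇒∣ {i} i~0 = subst (m ∣_) (ℤ.+-identityʳ i) (difference i~0)

  integersModulo : CommutativeRing 0ℓ 0ℓ
  integersModulo = record
    { Carrier = ℤ
    ; _≈_     = _~_
    ; _+_     = _+_
    ; _*_     = _*_
    ; -_      = -_
    ; 0#      = + 0
    ; 1#      = + 1
    ; isCommutativeRing = record
      { isRing = record
        { +-isAbelianGroup = record
          { isGroup = record
            { isMonoid = record
              { isSemigroup = record
                { isMagma = record
                  { isEquivalence = record
                    { refl  = ~-reflexive refl
                    ; sym   = ~-sym
                    ; trans = ~-trans
                    }
                  ; ∙-cong = +-cong
                  }
                ; assoc = λ i j k → ~-reflexive (ℤ.+-assoc i j k)
                }
              ; identity = (λ i → ~-reflexive (ℤ.+-identityˡ i)) , (λ i → ~-reflexive (ℤ.+-identityʳ i))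
              }
            ; inverse = (λ i → ~-reflexive (ℤ.+-inverseˡ i)) , (λ i → ~-reflexive (ℤ.+-inverseʳ i))
            ; ⁻¹-cong = -‿cong
            }
          ; comm = λ i j → ~-reflexive (ℤ.+-comm i j)
          }
        ; *-cong     = *-cong
        ; *-assoc    = λ i j k → ~-reflexive (ℤ.*-assoc i j k)
        ; *-identity = (λ i → ~-reflexive (ℤ.*-identityˡ i)) , (λ i → ~-reflexive (ℤ.*-identityʳ i))
        ; distrib    = (λ i j k → ~-reflexive (ℤ.*-distribˡ-+ i j k))
                     , (λ i j k → ~-reflexive (ℤ.*-distribʳ-+ i j k))
        }
      ; *-comm = λ i j → ~-reflexive (ℤ.*-comm i j)
      }
    }

-- From the natural-number series of the definitions to truncated series modulo `m`.

module PartitionSeries (m : ℤ) (N : ℕ) where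

  open import Data.List.Base using (applyUpTo)
  open import Data.List.Properties using (map-upTo)
  open import Data.Nat.Base using (_%_)
  open import Data.Nat.Divisibility using (_∣_; _∣0; m%n≡0⇒n∣m; n∣m⇒m%n≡0; ∣-trans; ∣m∣n⇒∣m+n; m∣m*n)
  import Data.Nat.DivMod as ℕ
  open import Data.Nat.ListAction using (sum)
  open import Data.Sum.Base using (_⊎_; inj₁; inj₂)
  open import Relation.Nullary.Negation.Core using (contradiction)

  open import Defs using (geom; one; partialProd; _·_; _^ˢ_)
  open IntegersModulo m using (integersModulo; _~_; ~-reflexive; ~-trans)
  private module Mod = IntegersModulo m
  open AntidiagonalSums integersModulo
  open TruncatedSeries integersModulo N
  open CommutativeRing truncatedSeries hiding (zero)
  open import Algebra.Properties.CommutativeSemiring.Exp (CommutativeRing.commutativeSemiring truncatedSeries)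
  open IntegerMultiples truncatedSeries using (⟦_⟧; ⟦suc⟧; solve; _:*_; _:-_; :-_; con; _:=_)

  x^[1+N]≈0 : x ^ suc N ≈ 0#
  x^[1+N]≈0 n n≤N = x↑-coefficient (suc N) n (ℕ.<⇒≢ (s≤s n≤N))

  ⟦+⟧≈const : ∀ i → ⟦ + i ⟧ ≈ const (+ i)
  ⟦+⟧≈const zero    zero    _ = ~-reflexive ≡.refl
  ⟦+⟧≈const zero    (suc n) _ = ~-reflexive ≡.refl
  ⟦+⟧≈const (suc i) n n≤N = ~-trans (⟦suc⟧ i n n≤N)
    (~-trans (Mod.+-cong (~-reflexive {const (+ 1) n} ≡.refl) (⟦+⟧≈const i n n≤N)) (const-suc n))
    where
    const-suc : ∀ n → const (+ 1) n ℤ.+ const (+ i) n ~ const (+ suc i) n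
    const-suc zero    = ~-reflexive ≡.refl
    const-suc (suc n) = ~-reflexive ≡.refl

  ⟦⟧≈const : ∀ i → ⟦ i ⟧ ≈ const i
  ⟦⟧≈const (+ i)    n n≤N = ⟦+⟧≈const i n n≤N
  ⟦⟧≈const -[1+ i ] n n≤N = ~-trans (Mod.-‿cong (⟦+⟧≈const (suc i) n n≤N)) (const-neg n)
    where
    const-neg : ∀ n → ℤ.- const (+ suc i) n ~ const -[1+ i ] n
    const-neg zero    = ~-reflexive ≡.refl
    const-neg (suc n) = ~-reflexive ≡.refl

  embed : (ℕ → ℕ) → Series
  embed f n = + f n

  sum-applyUpTo : ∀ n (h : ℕ → ℕ → ℕ) →
                  + sum (applyUpTo (λ i → h i (n ℕ.∸ i)) (suc n)) ≡ ∑ n (λ i j → + h i j)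
  sum-applyUpTo zero    h = ≡.cong +_ (ℕ.+-identityʳ (h 0 0))
  sum-applyUpTo (suc n) h = ≡.cong (λ i → + h 0 (suc n) ℤ.+ i) (sum-applyUpTo n (λ i j → h (suc i) j))

  embed-· : ∀ f g → embed (f · g) ≈ embed f * embed g
  embed-· f g n _ = ~-trans (~-reflexive (≡.trans
    (≡.cong (λ l → + sum l) (map-upTo (λ i → f i ℕ.* g (n ℕ.∸ i)) (suc n)))
    (sum-applyUpTo n (λ i j → f i ℕ.* g j))))
    (∑-cong n (λ i j → ~-reflexive (ℤ.pos-* (f i) (g j))))

  embed-one : embed one ≈ 1#
  embed-one zero    _ = ~-reflexive ≡.refl
  embed-one (suc n) _ = ~-reflexive ≡.refl

  embed-^ˢ : ∀ f k → embed (f ^ˢ k) ≈ embed f ^ k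
  embed-^ˢ f zero    = embed-one
  embed-^ˢ f (suc k) = trans (embed-· f (f ^ˢ k)) (*-congˡ {embed f} (embed-^ˢ f k))

  indicator : ℕ → ℕ
  indicator zero    = 1
  indicator (suc _) = 0

  -- Presents `geom` as a function of the remainder, into which equalities of remainders can be
  -- substituted.
  geom-indicator : ∀ i n → geom i n ≡ indicator (n % suc i)
  geom-indicator i n with n % suc i
  ... | zero  = ≡.refl
  ... | suc _ = ≡.refl

  -- Subtracting the copy shifted by `suc i` cancels all coefficients from `suc i` on, by
  -- periodicity of the remainder. Below that only the coefficient at 0 is nonzero.
  geom-inverse : ∀ i → embed (geom i) * (1# - x ^ suc i) ≈ 1#
  geom-inverse i = trans
    (solve 2 (λ g y → g :* (con (+ 1) :- y) := g :- y :* g) refl (embed (geom i)) (x ^ suc i))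
    coefficients
    where
    coefficients : embed (geom i) - x ^ suc i * embed (geom i) ≈ 1#
    coefficients n _ with suc i ℕ.≤? n
    ... | no i≮n = ~-trans (Mod.+-cong (~-reflexive (≡.cong +_ (≡.trans (geom-indicator i n)
            (≡.cong indicator (ℕ.m<n⇒m%n≡m (ℕ.≰⇒> i≮n))))))
            (Mod.-‿cong (x↑-⊛-< (suc i) (embed (geom i)) n (ℕ.≰⇒> i≮n))))
            (value n)
      where
      value : ∀ n → + indicator n ℤ.- + 0 ~ const (+ 1) n
      value zero    = ~-reflexive ≡.refl
      value (suc n) = ~-reflexive ≡.refl
    coefficients n@(suc _) _ | yes i<n = ~-trans
      (Mod.+-cong (~-reflexive {+ geom i n} ≡.refl) (Mod.-‿cong (x↑-⊛-∸ (suc i) (embed (geom i)) n i<n)))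
      (~-reflexive (≡.trans (≡.cong (λ j → + geom i n ℤ.- + j) periodic) (ℤ.+-inverseʳ (+ geom i n))))
      where
      periodic : geom i (n ℕ.∸ suc i) ≡ geom i n
      periodic = ≡.trans (geom-indicator i (n ℕ.∸ suc i)) (≡.trans
        (≡.cong indicator (ℕ.m≤n⇒[n∸m]%m≡n%m i<n)) (≡.sym (geom-indicator i n)))

  open GeometricFactors truncatedSeries x (λ i → embed (geom i)) geom-inverse public

  embed-partialProd : ∀ c n → embed (partialProd (suc c) n) ≈ colouredProd c n
  embed-partialProd c zero    = embed-one
  embed-partialProd c (suc n) = trans (embed-· (partialProd (suc c) n) _)
    (*-cong (embed-partialProd c n)
      (trans (embed-· (geom n) _) (*-congˡ {embed (geom n)} (embed-^ˢ (geom (n ℕ.+ suc n)) c))))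

  module _ (p′ : ℕ) where

    private
      p = suc p′

    SupportedOnMultiples : Series → Set
    SupportedOnMultiples f = ∀ n → p ∣ n ⊎ f n ~ + 0

    -- If `p` does not divide `n = i + j`, it cannot divide both `i` and `j`.
    ⊛-supported : ∀ {f g} → SupportedOnMultiples f → SupportedOnMultiples g →
                  SupportedOnMultiples (f ⊛ g)
    ⊛-supported {f} {g} f-supp g-supp n with n % p in n%p
    ... | zero  = inj₁ (m%n≡0⇒n∣m n p n%p)
    ... | suc r = inj₂ (∑-zero n λ i j i+j≡n → product i j i+j≡n)
      where
      product : ∀ i j → i ℕ.+ j ≡ n → f i ℤ.* g j ~ + 0
      product i j i+j≡n with f-supp i | g-supp j
      ... | inj₂ fi~0 | _ = ~-trans (Mod.*-cong fi~0 (~-reflexive ≡.refl)) (~-reflexive ≡.refl)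
      ... | inj₁ _ | inj₂ gj~0 = ~-trans (Mod.*-cong (~-reflexive {f i} ≡.refl) gj~0) (~-reflexive (ℤ.*-zeroʳ (f i)))
      ... | inj₁ p∣i | inj₁ p∣j = contradiction
        (≡.trans (≡.sym n%p) (n∣m⇒m%n≡0 n p (≡.subst (p ∣_) i+j≡n (∣m∣n⇒∣m+n p∣i p∣j)))) λ ()

    geom-supported : ∀ i → p ∣ suc i → SupportedOnMultiples (embed (geom i))
    geom-supported i p∣1+i n = support (n % suc i) ≡.refl
      where
      support : ∀ r → n % suc i ≡ r → p ∣ n ⊎ + geom i n ~ + 0
      support zero    n%[1+i]≡r = inj₁ (∣-trans p∣1+i (m%n≡0⇒n∣m n (suc i) n%[1+i]≡r))
      support (suc r) n%[1+i]≡r = inj₂ (~-reflexive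
        (≡.cong +_ (≡.trans (geom-indicator i n) (≡.cong indicator n%[1+i]≡r))))

    dilatedProd-supported : ∀ n → SupportedOnMultiples (dilatedProd p′ n)
    dilatedProd-supported zero    zero    = inj₁ (p ∣0)
    dilatedProd-supported zero    (suc n) = inj₂ (~-reflexive ≡.refl)
    -- The new factor has period `suc (n + p′ * suc n)`, which computes to `p * suc n`.
    dilatedProd-supported (suc n) = ⊛-supported (dilatedProd-supported n)
      (geom-supported _ (m∣m*n {p} (suc n)))

-- Sums of two squares divisible by `p`.

module Anisotropy (p : ℕ) .{{_ : NonZero p}} where

  open import Data.Fin.Base using (Fin; toℕ; fromℕ<)
  open import Data.Fin.Properties using (all?; toℕ-fromℕ<)
  open import Data.Integer.Base using (_+_; _*_)
  open import Data.Integer.DivMod using (_%ℕ_; _/ℕ_; n%ℕd<d; a≡a%ℕn+[a/ℕn]*n)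
  open import Data.Integer.Divisibility.Signed using (_∣_; divides; ∣⇒∣ᵤ)
  open import Data.Integer.Tactic.RingSolver using (solve-∀)
  import Data.Nat.Divisibility as ℕ
  open import Relation.Binary.PropositionalEquality
  open import Relation.Nullary.Decidable.Core using (Dec; _→-dec_)

  open IntegersModulo (+ p)

  -- A finite check on residues, in place of the argument that -1 is not a square modulo `p`. Only
  -- the second coordinate is recorded, since it is the one that occurs in the weights.
  AnisotropicResidues : Set
  AnisotropicResidues = (a b : Fin p) →
    p ℕ.∣ toℕ a ℕ.* toℕ a ℕ.+ toℕ b ℕ.* toℕ b → toℕ b ≡ 0

  anisotropicResidues? : Dec AnisotropicResidues
  anisotropicResidues? = all? λ a → all? λ b →
    (p ℕ.∣? toℕ a ℕ.* toℕ a ℕ.+ toℕ b ℕ.* toℕ b) →-dec (toℕ b ℕ.≟ 0)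

  residue : ∀ i → i ~ + (i %ℕ p)
  residue i = congruent (divides (i /ℕ p)
    (trans (cong (λ j → j Data.Integer.Base.- + (i %ℕ p)) (a≡a%ℕn+[a/ℕn]*n i p))
           (cancel (+ (i %ℕ p)) (i /ℕ p * + p))))
    where
    cancel : ∀ i j → i + j Data.Integer.Base.- i ≡ j
    cancel = solve-∀

  anisotropic : AnisotropicResidues → ∀ x y → + p ∣ x * x + y * y → + p ∣ y
  anisotropic residues x y p∣x²+y² = ~0⇒∣ (~-trans (residue y) (~-reflexive (cong +_ y%p≡0)))
    where
    a = fromℕ< (n%ℕd<d x p)
    b = fromℕ< (n%ℕd<d y p)
    a≡ = toℕ-fromℕ< (n%ℕd<d x p)
    b≡ = toℕ-fromℕ< (n%ℕd<d y p)
    squares : x * x + y * y ~ + (toℕ a ℕ.* toℕ a ℕ.+ toℕ b ℕ.* toℕ b)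
    squares rewrite a≡ | b≡ = ~-trans
      (+-cong (*-cong (residue x) (residue x)) (*-cong (residue y) (residue y)))
      (~-reflexive (sym (cong₂ _+_ (ℤ.pos-* (x %ℕ p) (x %ℕ p)) (ℤ.pos-* (y %ℕ p) (y %ℕ p)))))
    y%p≡0 : y %ℕ p ≡ 0
    y%p≡0 = trans (sym b≡) (residues a b (∣⇒∣ᵤ (~0⇒∣ (~-trans (~-sym squares) (∣⇒~0 p∣x²+y²)))))

-- Vanishing of coefficients of theta products modulo `p`.

module ThetaCoefficients (p′ : ℕ)
  (anisotropic : ∀ x y → + suc p′ ℤ.∣ x ℤ.* x ℤ.+ y ℤ.* y → + suc p′ ℤ.∣ y)
  (N : ℕ) (p∣24N+2 : + suc p′ ℤ.∣ + 24 ℤ.* + N ℤ.+ + 2) where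

  open import Data.Integer.Divisibility.Signed using (_∣_; ∣m∣n⇒∣m-n; ∣n⇒∣m*n; ∣ᵤ⇒∣)
  open import Data.Integer.Tactic.RingSolver using (solve-∀)
  open import Data.Sum.Base using (inj₁; inj₂)

  open IntegersModulo (+ suc p′) using (integersModulo; _~_; ~-reflexive; ~-trans; ∣⇒~0)
  private module Mod = IntegersModulo (+ suc p′)
  open AntidiagonalSums integersModulo using (∑-zero)
  open TruncatedSeries integersModulo N
  open CommutativeRing truncatedSeries hiding (zero)
  open import Algebra.Properties.Semiring.Exp (CommutativeRing.semiring truncatedSeries)
  open IntegerMultiples truncatedSeries using (⟦_⟧)
  private module ∑~ = IntervalSums integersModulo
  open IntervalSums truncatedSeries using (∑ℤ; ∑ℤ-*-∑ℤ)
  open SeriesSums integersModulo N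
  open ThetaExponents
  open LatticeInvolution truncatedSeries x using (monomial-*; pentagonalTermWith; weightedPentagonalTerm)
  open PartitionSeries (+ suc p′) N

  monomial-coefficient : ∀ w e i → i ℕ.≤ N → (e ≡ i → + suc p′ ∣ w) → (⟦ w ⟧ * x ^ e) i ~ + 0
  monomial-coefficient w e i i≤N p∣w = ~-trans
    (*-cong {⟦ w ⟧} {const w} {x ^ e} {x ^ e} (⟦⟧≈const w) (refl {x ^ e}) i i≤N)
    (~-trans (const-⊛ w (x ^ e) i) product~0)
    where
    product~0 : w ℤ.* (x ^ e) i ~ + 0
    product~0 with i ℕ.≟ e
    ... | yes ≡.refl = ~-trans (Mod.*-cong (∣⇒~0 (p∣w ≡.refl)) (~-reflexive {(x ^ e) i} ≡.refl))
                               (~-reflexive (ℤ.*-zeroˡ ((x ^ e) i)))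
    ... | no  i≢e    = ~-trans (Mod.*-cong (~-reflexive {w} ≡.refl) (x↑-coefficient e i i≢e))
                               (~-reflexive (ℤ.*-zeroʳ w))

  thetaProduct-coefficient : ∀ n a b i → i ℕ.≤ N →
    (∀ k l → pentagonal k ℕ.+ pentagonal l ≡ i → + suc p′ ∣ a k ℤ.* b l) →
    (∑ℤ n (pentagonalTermWith a) * ∑ℤ n (pentagonalTermWith b)) i ~ + 0
  thetaProduct-coefficient n a b i i≤N p∣ab = ~-trans
    (∑ℤ-*-∑ℤ n n (pentagonalTermWith a) (pentagonalTermWith b) i i≤N)
    (~-trans (~-reflexive (∑ℤ-coefficient n (λ k → ∑ℤ n (λ l → pentagonalTermWith a k * pentagonalTermWith b l)) i))
    (∑~.∑ℤ-zero n λ k → ~-trans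
      (~-reflexive (∑ℤ-coefficient n (λ l → pentagonalTermWith a k * pentagonalTermWith b l) i))
      (∑~.∑ℤ-zero n λ l → ~-trans (monomial-* (a k) (b l) (pentagonal k) (pentagonal l) i i≤N)
        (monomial-coefficient (a k ℤ.* b l) (pentagonal k ℕ.+ pentagonal l) i i≤N (p∣ab k l)))))

  -- Completing the square: `24 · k(3k + 1)/2 + 1 = (6k + 1)²`. This is the origin of 24 and 2.
  sumOfSquares : ∀ k l → + 24 ℤ.* + (pentagonal k ℕ.+ pentagonal l) ℤ.+ + 2
    ≡ (+ 6 ℤ.* k ℤ.+ + 1) ℤ.* (+ 6 ℤ.* k ℤ.+ + 1) ℤ.+ (+ 6 ℤ.* l ℤ.+ + 1) ℤ.* (+ 6 ℤ.* l ℤ.+ + 1)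
  sumOfSquares k l = ≡.trans (regroup (+ pentagonal k) (+ pentagonal l))
    (≡.trans (≡.cong₂ (λ i j → + 12 ℤ.* (i ℤ.+ j) ℤ.+ + 2) (pentagonal-double k) (pentagonal-double l))
             (square k l))
    where
    regroup : ∀ i j → + 24 ℤ.* (i ℤ.+ j) ℤ.+ + 2 ≡ + 12 ℤ.* (+ 2 ℤ.* i ℤ.+ + 2 ℤ.* j) ℤ.+ + 2
    regroup = solve-∀
    square : ∀ k l → + 12 ℤ.* (k ℤ.* (+ 3 ℤ.* k ℤ.+ + 1) ℤ.+ l ℤ.* (+ 3 ℤ.* l ℤ.+ + 1)) ℤ.+ + 2
      ≡ (+ 6 ℤ.* k ℤ.+ + 1) ℤ.* (+ 6 ℤ.* k ℤ.+ + 1) ℤ.+ (+ 6 ℤ.* l ℤ.+ + 1) ℤ.* (+ 6 ℤ.* l ℤ.+ + 1)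
    square = solve-∀

  -- In `i + j = N` only multiples `j` of `p` contribute, and then `p` divides `24i + 2` as well. So
  -- `p` divides the sum of two squares attached to each term at `i`, hence the weight `6l + 1` of
  -- the second series. The first weight is arbitrary, which covers both P F and F².
  coefficient-divisible : ∀ n a {H} → SupportedOnMultiples p′ H →
    (∑ℤ n (pentagonalTermWith a) * ∑ℤ n weightedPentagonalTerm * H) N ~ + 0
  coefficient-divisible n a {H} supported = ∑-zero N λ i j i+j≡N → product~0 i j i+j≡N (supported j)
    where
    G = ∑ℤ n (pentagonalTermWith a) * ∑ℤ n weightedPentagonalTerm
    product~0 : ∀ i j → i ℕ.+ j ≡ N → _ → G i ℤ.* H j ~ + 0
    product~0 i j i+j≡N (inj₂ Hj~0) = ~-trans (Mod.*-cong (~-reflexive {G i} ≡.refl) Hj~0)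
                                              (~-reflexive (ℤ.*-zeroʳ (G i)))
    product~0 i j i+j≡N (inj₁ p∣j)  = ~-trans (Mod.*-cong Gi~0 (~-reflexive {H j} ≡.refl))
                                              (~-reflexive (ℤ.*-zeroˡ (H j)))
      where
      p∣24i+2 : + suc p′ ∣ + 24 ℤ.* + i ℤ.+ + 2
      p∣24i+2 = ≡.subst (+ suc p′ ∣_) (cancel (+ i) (+ j))
        (∣m∣n⇒∣m-n (≡.subst (λ k → + suc p′ ∣ + 24 ℤ.* + k ℤ.+ + 2) (≡.sym i+j≡N) p∣24N+2)
                   (∣n⇒∣m*n (+ 24) (∣ᵤ⇒∣ p∣j)))
        where
        cancel : ∀ i j → + 24 ℤ.* (i ℤ.+ j) ℤ.+ + 2 ℤ.- + 24 ℤ.* j ≡ + 24 ℤ.* i ℤ.+ + 2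
        cancel = solve-∀
      Gi~0 : G i ~ + 0
      Gi~0 = thetaProduct-coefficient n a (λ l → + 6 ℤ.* l ℤ.+ + 1) i
        (≡.subst (i ℕ.≤_) i+j≡N (ℕ.m≤m+n i j)) λ k l e≡i →
        ∣n⇒∣m*n (a k) (anisotropic (+ 6 ℤ.* k ℤ.+ + 1) (+ 6 ℤ.* l ℤ.+ + 1)
          (≡.subst (+ suc p′ ∣_) (sumOfSquares k l)
            (≡.subst (λ e → + suc p′ ∣ + 24 ℤ.* + e ℤ.+ + 2) (≡.sym e≡i) p∣24i+2)))

-- The congruences modulo 7 and 11.

open import Defs
open import Data.Nat using (ℕ; _+_; _*_)
open import Data.Nat.Divisibility using (_∣_)
open import Data.Product using (_×_)

open import Data.Nat.Divisibility using (divides; ∣-refl; ∣m∣n⇒∣m+n; ∣n⇒∣m*n)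
open import Data.Nat.Properties using (≤-refl)
open import Data.Nat.Tactic.RingSolver using (solve-∀)
open import Data.Product using (_,_)
open import Relation.Nullary.Decidable using (from-yes)
open Anisotropy
open ThetaExponents using (alternating; cutoff)
open ThetaCoefficients using (coefficient-divisible)

module _ (p′ : ℕ) (N : ℕ) where

  open IntegersModulo (+ suc p′)
  open TruncatedSeries integersModulo N
  open PartitionSeries (+ suc p′) N
  open CommutativeRing truncatedSeries using (_≈_; 0#; 1#) renaming (_+_ to _⊞_; _*_ to _⊠_)
  open IntegerMultiples truncatedSeries using (⟦_⟧)
  open IntervalSums truncatedSeries using (∑ℤ)
  open LatticeInvolution truncatedSeries x using (pentagonalTermWith; weightedPentagonalTerm)

  ⟦p⟧≈0 : ⟦ + suc p′ ⟧ ≈ 0#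
  ⟦p⟧≈0 n n≤N = ~-trans (⟦⟧≈const (+ suc p′) n n≤N) (const-p n)
    where
    const-p : ∀ n → const (+ suc p′) n ~ + 0
    const-p zero    = ∣⇒~0 ℤ.∣-refl
    const-p (suc n) = ~-reflexive ≡.refl

  const-half : ∀ h → h ℤ.* + 2 ~ + 1 → const h ⊠ (1# ⊞ 1#) ≈ 1#
  const-half h h*2~1 zero    _ = h*2~1
  const-half h h*2~1 (suc n) _ =
    ~-trans (const-⊛ h (1# ⊞ 1#) (suc n)) (~-reflexive (ℤ.*-zeroʳ h))

  module _ (residues : AnisotropicResidues (suc p′)) (p∣24N+2 : + suc p′ ℤ.∣ + 24 ℤ.* + N ℤ.+ + 2) where

    partialProd-divisible : ∀ c n w → colouredProd c N ≈
      ∑ℤ n (pentagonalTermWith w) ⊠ ∑ℤ n weightedPentagonalTerm ⊠ dilatedProd p′ (suc N) →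
      suc p′ ∣ partialProd (suc c) N N
    partialProd-divisible c n w identity = ℤ.∣⇒∣ᵤ (~0⇒∣
      (~-trans (embed-partialProd c N N ≤-refl) (~-trans (identity N ≤-refl)
        (coefficient-divisible p′ (anisotropic (suc p′) residues) N p∣24N+2 n w
          {dilatedProd p′ (suc N)} (dilatedProd-supported p′ (suc N))))))

  module _ (h : ℤ) (h*2~1 : h ℤ.* + 2 ~ + 1) where
    open PartitionIdentities.Truncated truncatedSeries x (λ i → embed (geom i)) geom-inverse
      N x^[1+N]≈0 (const h) (const-half h h*2~1) public

-- `24(pn + r) + 2` is a multiple of `p` plus `24r + 2`, so a single quotient `s` settles all `n`.
p∣24[pn+r]+2 : ∀ p n r s → 24 * r + 2 ≡ s * p → + p ℤ.∣ + 24 ℤ.* + (p * n + r) ℤ.+ + 2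
p∣24[pn+r]+2 p n r s eq = ≡.subst (λ i → + p ℤ.∣ i ℤ.+ + 2) (ℤ.pos-* 24 (p * n + r))
  (ℤ.∣ᵤ⇒∣ (≡.subst (p ∣_) (regroup p n r)
    (∣m∣n⇒∣m+n (∣n⇒∣m*n (24 * n) (∣-refl {p})) (divides s eq))))
  where
  regroup : ∀ p n r → 24 * n * p + (24 * r + 2) ≡ 24 * (p * n + r) + 2
  regroup = solve-∀

theorem1p4 : (n : ℕ) → (7 ∣ a 3 (7 * n + 4)) × (11 ∣ a 5 (11 * n + 10))
theorem1p4 n =
    partialProd-divisible 6 N₃ residues₇ 7∣24N+2 2 (cutoff (suc N₃)) (λ k → alternating ∣ k ∣)
      (colouredProd-2 6 N₃ (+ 4) 4*2~1 (⟦p⟧≈0 6 N₃))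
  , partialProd-divisible 10 N₅ residues₁₁ 11∣24N+2 4 (cutoff (suc N₅)) (λ k → + 6 ℤ.* k ℤ.+ + 1)
      (colouredProd-4 10 N₅ (+ 6) 6*2~1 (⟦p⟧≈0 10 N₅))
  where
  N₃ = 7 * n + 4
  N₅ = 11 * n + 10
  residues₇ = from-yes (anisotropicResidues? 7)
  residues₁₁ = from-yes (anisotropicResidues? 11)
  -- `24 · 4 + 2 = 98 = 14 · 7` and `24 · 10 + 2 = 242 = 22 · 11`.
  7∣24N+2 = p∣24[pn+r]+2 7 n 4 14 ≡.refl
  11∣24N+2 = p∣24[pn+r]+2 11 n 10 22 ≡.refl
  -- The inverses of 2: `4 · 2 = 1 + 7` and `6 · 2 = 1 + 11`.
  4*2~1 = IntegersModulo.congruent (ℤ.divides (+ 1) ≡.refl)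
  6*2~1 = IntegersModulo.congruent (ℤ.divides (+ 1) ≡.refl)
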